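{- Let $n \in \mathbb{N}$ be even. For every $\epsilon > 0$ sufficiently small, there exists a set $X$ of $n$ points in $\mathbb{R}^2$ (an instance of the Euclidean TSP in the plane) such that the approximation ratio of X-opt on $X$ is at least $\frac{n}{2}(1-\epsilon)$. That is, there is a noncrossing tour $T$ through $X$ with $\ell(T) \geq \frac{n}{2}(1-\epsilon)\cdot \ell(T^*)$, where $T^*$ is a shortest tour through $X$. In particular, the approximation ratio can be brought arbitrarily close to $\frac{n}{2}$.
   Context: Euclidean TSP in the plane: given a finite set $X \subset \mathbb{R}^2$, a tour is a Hamiltonian cycle on $X$; the length of an edge $\{x,y\}$ is the Euclidean distance $d(x,y)$, and the length $\ell(T)$ of a tour is the sum of its edge lengths. For an edge $e=\{x,y\}$, $L(e)$ denotes the closed line segment from $x$ to $y$. A set of edges is noncrossing if no two of its edges have intersecting line segments (other than at a shared endpoint). X-opt is the local search heuristic that repeatedly replaces two edges of the tour whose line segments intersect by two other edges so as to obtain a tour again; its local optima are exactly the noncrossing tours. The approximation ratio of X-opt on an instance is the ratio of the length of the longest noncrossing tour to the length of an optimal (shortest) tour. -}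

module Defs where

open import Data.Bool using (if_then_else_)
open import Data.Fin using (Fin; toℕ)
open import Data.Fin.Permutation using (Permutation′; _⟨$⟩ʳ_)
open import Data.Integer as ℤ using (+_)
import Data.Integer.Properties as ℤ
open import Data.Nat as ℕ using (ℕ; zero; suc)
open import Data.Nat.DivMod using (_mod_)
import Data.Nat.Properties as ℕ
open import Data.Product using (∃-syntax; _×_; _,_)
open import Data.Rational as ℚ using (ℚ; 0ℚ; 1ℚ; ½; ∣_∣)
import Data.Rational.Properties as ℚ
import Data.Rational.Unnormalised as ℚᵘ
import Data.Rational.Unnormalised.Properties as ℚᵘ
open import Data.Rational.Solver using (module +-*-Solver)
open import Data.Sum using (_⊎_; inj₁; inj₂)
open import Data.Vec.Functional using (foldr)
open import Relation.Binary.PropositionalEquality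
open import Relation.Nullary using (¬_; yes; no; contradiction; does)

open +-*-Solver using (solve; _:+_; _:*_; _:-_; :-_; _:=_; con)

module ℚ-Lemmas where

  pos* : ∀ {p q} → 0ℚ ℚ.< p → 0ℚ ℚ.< q → 0ℚ ℚ.< p ℚ.* q
  pos* {p} {q} 0<p 0<q =
    ℚ.positive⁻¹ _ {{ℚ.pos*pos⇒pos p {{ℚ.positive 0<p}} q {{ℚ.positive 0<q}}}}

  0<½ : 0ℚ ℚ.< ½
  0<½ = ℚ.positive⁻¹ ½

  0<1 : 0ℚ ℚ.< 1ℚ
  0<1 = ℚ.positive⁻¹ 1ℚ

  nonNeg+ : ∀ {p q} → 0ℚ ℚ.≤ p → 0ℚ ℚ.≤ q → 0ℚ ℚ.≤ p ℚ.+ q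
  nonNeg+ {p} {q} 0≤p 0≤q = ℚ.nonNegative⁻¹ (p ℚ.+ q)
    {{ℚ.nonNeg+nonNeg⇒nonNeg p {{ℚ.nonNegative 0≤p}} q {{ℚ.nonNegative 0≤q}}}}

  nonNeg+pos : ∀ {p q} → 0ℚ ℚ.≤ p → 0ℚ ℚ.< q → 0ℚ ℚ.< p ℚ.+ q
  nonNeg+pos {p} {q} 0≤p 0<q = ℚ.positive⁻¹ (p ℚ.+ q)
    {{ℚ.nonNeg+pos⇒pos p {{ℚ.nonNegative 0≤p}} q {{ℚ.positive 0<q}}}}

  nonNeg* : ∀ {p q} → 0ℚ ℚ.≤ p → 0ℚ ℚ.≤ q → 0ℚ ℚ.≤ p ℚ.* q
  nonNeg* {p} {q} 0≤p 0≤q = ℚ.nonNegative⁻¹ (p ℚ.* q)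
    {{ℚ.nonNeg*nonNeg⇒nonNeg p {{ℚ.nonNegative 0≤p}} q {{ℚ.nonNegative 0≤q}}}}

  half : ∀ p → p ℚ.* ½ ℚ.+ p ℚ.* ½ ≡ p
  half = solve 1 (λ p → p :* con ½ :+ p :* con ½ := p) refl

  *-mono-≤ : ∀ {p q r s} → 0ℚ ℚ.≤ p → 0ℚ ℚ.≤ s → p ℚ.≤ q → r ℚ.≤ s → p ℚ.* r ℚ.≤ q ℚ.* s
  *-mono-≤ {p} {s = s} 0≤p 0≤s p≤q r≤s = ℚ.≤-trans
    (ℚ.*-monoˡ-≤-nonNeg p {{ℚ.nonNegative 0≤p}} r≤s)
    (ℚ.*-monoʳ-≤-nonNeg s {{ℚ.nonNegative 0≤s}} p≤q)

  p<p+q : ∀ p {q} → 0ℚ ℚ.< q → p ℚ.< p ℚ.+ q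
  p<p+q p {q} 0<q = subst (ℚ._< p ℚ.+ q) (ℚ.+-identityʳ p) (ℚ.+-monoʳ-< p 0<q)

  <-≤-total : ∀ p q → p ℚ.< q ⊎ q ℚ.≤ p
  <-≤-total p q with p ℚ.<? q
  ... | yes p<q = inj₁ p<q
  ... | no  p≮q = inj₂ (ℚ.≮⇒≥ p≮q)

  p-q<r⇒p<q+r : ∀ p q r → p ℚ.- q ℚ.< r → p ℚ.< q ℚ.+ r
  p-q<r⇒p<q+r p q r h = subst (ℚ._< q ℚ.+ r)
    (solve 2 (λ p q → q :+ (p :- q) := p) refl p q) (ℚ.+-monoʳ-< q h)

  p<q+r⇒p-q<r : ∀ p q r → p ℚ.< q ℚ.+ r → p ℚ.- q ℚ.< r
  p<q+r⇒p-q<r p q r h = subst (p ℚ.- q ℚ.<_)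
    (solve 2 (λ q r → (q :+ r) :- q := r) refl q r) (ℚ.+-monoˡ-< (ℚ.- q) h)

  ∣-∣< : ∀ {p r} → p ℚ.< r → ℚ.- p ℚ.< r → ∣ p ∣ ℚ.< r
  ∣-∣< {p} p<r -p<r with ℚ.∣p∣≡p∨∣p∣≡-p p
  ... | inj₁ eq = subst (ℚ._< _) (sym eq) p<r
  ... | inj₂ eq = subst (ℚ._< _) (sym eq) -p<r

  p≤∣p∣ : ∀ p → p ℚ.≤ ∣ p ∣
  p≤∣p∣ p with ℚ.≤-total 0ℚ p
  ... | inj₁ 0≤p = ℚ.≤-reflexive (sym (ℚ.0≤p⇒∣p∣≡p 0≤p))
  ... | inj₂ p≤0 = ℚ.≤-trans p≤0 (ℚ.0≤∣p∣ p)

  ∣p-q∣≡∣q-p∣ : ∀ p q → ∣ p ℚ.- q ∣ ≡ ∣ q ℚ.- p ∣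
  ∣p-q∣≡∣q-p∣ p q = trans
    (cong ∣_∣ (solve 2 (λ p q → p :- q := :- (q :- p)) refl p q))
    (ℚ.∣-p∣≡∣p∣ (q ℚ.- p))

open ℚ-Lemmas

-- The real numbers are Cauchy sequences of rationals up to _≈_.

IsCauchy : (ℕ → ℚ) → Set
IsCauchy x = ∀ ε → 0ℚ ℚ.< ε →
  ∃[ N ] (∀ m n → N ℕ.≤ m → N ℕ.≤ n → ∣ x m ℚ.- x n ∣ ℚ.< ε)

record ℝ : Set where
  constructor mkℝ
  field
    seq    : ℕ → ℚ
    cauchy : IsCauchy seq

open ℝ public

infix  4 _≈_ _≤_ _<_
infixl 6 _+_ _-_
infixl 7 _*_
infix  8 -_

_≈_ : ℝ → ℝ → Set
x ≈ y = ∀ ε → 0ℚ ℚ.< ε →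
  ∃[ N ] (∀ n → N ℕ.≤ n → ∣ seq x n ℚ.- seq y n ∣ ℚ.< ε)

_≤_ : ℝ → ℝ → Set
x ≤ y = ∀ ε → 0ℚ ℚ.< ε →
  ∃[ N ] (∀ n → N ℕ.≤ n → seq x n ℚ.≤ seq y n ℚ.+ ε)

_<_ : ℝ → ℝ → Set
x < y = ∃[ ε ] 0ℚ ℚ.< ε ×
  ∃[ N ] (∀ n → N ℕ.≤ n → seq x n ℚ.+ ε ℚ.≤ seq y n)

fromℚ : ℚ → ℝ
fromℚ q = mkℝ (λ _ → q) λ ε 0<ε →
  0 , λ _ _ _ _ → subst (λ d → ∣ d ∣ ℚ.< ε) (sym (ℚ.+-inverseʳ q)) 0<ε

0ℝ 1ℝ : ℝ
0ℝ = fromℚ 0ℚ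
1ℝ = fromℚ 1ℚ

module Cauchy-Lemmas where

  +-cauchy : ∀ x y → IsCauchy x → IsCauchy y → IsCauchy (λ n → x n ℚ.+ y n)
  +-cauchy x y cx cy ε 0<ε
    with cx (ε ℚ.* ½) (pos* 0<ε 0<½) | cy (ε ℚ.* ½) (pos* 0<ε 0<½)
  ... | M , hM | N , hN = M ℕ.⊔ N , λ m n m≥ n≥ → begin-strict
    ∣ (x m ℚ.+ y m) ℚ.- (x n ℚ.+ y n) ∣
      ≡⟨ cong ∣_∣ (solve 4 (λ a b c d → (a :+ b) :- (c :+ d) := (a :- c) :+ (b :- d))
                     refl (x m) (y m) (x n) (y n)) ⟩
    ∣ (x m ℚ.- x n) ℚ.+ (y m ℚ.- y n) ∣
      ≤⟨ ℚ.∣p+q∣≤∣p∣+∣q∣ (x m ℚ.- x n) (y m ℚ.- y n) ⟩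
    ∣ x m ℚ.- x n ∣ ℚ.+ ∣ y m ℚ.- y n ∣
      <⟨ ℚ.+-mono-< (hM m n (ℕ.m⊔n≤o⇒m≤o M N m≥) (ℕ.m⊔n≤o⇒m≤o M N n≥))
                    (hN m n (ℕ.m⊔n≤o⇒n≤o M N m≥) (ℕ.m⊔n≤o⇒n≤o M N n≥)) ⟩
    ε ℚ.* ½ ℚ.+ ε ℚ.* ½
      ≡⟨ half ε ⟩
    ε ∎
    where open ℚ.≤-Reasoning

  neg-cauchy : ∀ x → IsCauchy x → IsCauchy (λ n → ℚ.- x n)
  neg-cauchy x cx ε 0<ε with cx ε 0<ε
  ... | N , h = N , λ m n m≥ n≥ → subst (ℚ._< ε)
    (trans (∣p-q∣≡∣q-p∣ (x m) (x n))
      (cong ∣_∣ (solve 2 (λ a b → b :- a := (:- a) :- (:- b)) refl (x m) (x n))))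
    (h m n m≥ n≥)

  eventually-bounded : ∀ x → IsCauchy x →
    ∃[ B ] 0ℚ ℚ.< B × ∃[ N ] (∀ n → N ℕ.≤ n → ∣ x n ∣ ℚ.≤ B)
  eventually-bounded x cx with cx 1ℚ 0<1
  ... | N , h = ∣ x N ∣ ℚ.+ 1ℚ
              , nonNeg+pos (ℚ.0≤∣p∣ (x N)) 0<1
              , N , λ n n≥ → begin
    ∣ x n ∣
      ≡⟨ cong ∣_∣ (solve 2 (λ a b → a := b :+ (a :- b)) refl (x n) (x N)) ⟩
    ∣ x N ℚ.+ (x n ℚ.- x N) ∣
      ≤⟨ ℚ.∣p+q∣≤∣p∣+∣q∣ (x N) (x n ℚ.- x N) ⟩
    ∣ x N ∣ ℚ.+ ∣ x n ℚ.- x N ∣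
      ≤⟨ ℚ.+-monoʳ-≤ ∣ x N ∣ (ℚ.<⇒≤ (h n N n≥ ℕ.≤-refl)) ⟩
    ∣ x N ∣ ℚ.+ 1ℚ ∎
    where open ℚ.≤-Reasoning

  quotient : ∀ B ε → 0ℚ ℚ.< B → 0ℚ ℚ.< ε → ∃[ δ ] 0ℚ ℚ.< δ × B ℚ.* δ ≡ ε
  quotient B ε 0<B 0<ε = 1/B ℚ.* ε , pos* (ℚ.positive⁻¹ 1/B {{ℚ.1/pos⇒pos B}}) 0<ε ,
    trans (sym (ℚ.*-assoc B 1/B ε))
      (trans (cong (ℚ._* ε) (ℚ.*-inverseʳ B)) (ℚ.*-identityˡ ε))
    where
      instance
        B-pos = ℚ.positive 0<B
        B-nonZero = ℚ.pos⇒nonZero B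
      1/B = ℚ.1/ B

  *-close : ∀ a b c d {A B δ η ε} → 0ℚ ℚ.< A → 0ℚ ℚ.< B →
    A ℚ.* η ≡ ε ℚ.* ½ → B ℚ.* δ ≡ ε ℚ.* ½ →
    ∣ a ∣ ℚ.≤ A → ∣ d ∣ ℚ.≤ B →
    ∣ a ℚ.- c ∣ ℚ.< δ → ∣ b ℚ.- d ∣ ℚ.< η → ∣ a ℚ.* b ℚ.- c ℚ.* d ∣ ℚ.< ε
  *-close a b c d {A} {B} {δ} {η} {ε} 0<A 0<B Aη Bδ ∣a∣≤A ∣d∣≤B ∣a-c∣<δ ∣b-d∣<η = begin-strict
    ∣ a ℚ.* b ℚ.- c ℚ.* d ∣
      ≡⟨ cong ∣_∣ (solve 4 (λ a b c d → a :* b :- c :* d := d :* (a :- c) :+ a :* (b :- d))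
                     refl a b c d) ⟩
    ∣ d ℚ.* (a ℚ.- c) ℚ.+ a ℚ.* (b ℚ.- d) ∣
      ≤⟨ ℚ.∣p+q∣≤∣p∣+∣q∣ (d ℚ.* (a ℚ.- c)) (a ℚ.* (b ℚ.- d)) ⟩
    ∣ d ℚ.* (a ℚ.- c) ∣ ℚ.+ ∣ a ℚ.* (b ℚ.- d) ∣
      ≡⟨ cong₂ ℚ._+_ (ℚ.∣p*q∣≡∣p∣*∣q∣ d (a ℚ.- c)) (ℚ.∣p*q∣≡∣p∣*∣q∣ a (b ℚ.- d)) ⟩
    ∣ d ∣ ℚ.* ∣ a ℚ.- c ∣ ℚ.+ ∣ a ∣ ℚ.* ∣ b ℚ.- d ∣
      ≤⟨ ℚ.+-mono-≤
           (ℚ.*-monoʳ-≤-nonNeg ∣ a ℚ.- c ∣ {{ℚ.∣-∣-nonNeg (a ℚ.- c)}} ∣d∣≤B)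
           (ℚ.*-monoʳ-≤-nonNeg ∣ b ℚ.- d ∣ {{ℚ.∣-∣-nonNeg (b ℚ.- d)}} ∣a∣≤A) ⟩
    B ℚ.* ∣ a ℚ.- c ∣ ℚ.+ A ℚ.* ∣ b ℚ.- d ∣
      <⟨ ℚ.+-mono-<
           (ℚ.*-monoʳ-<-pos B {{ℚ.positive 0<B}} ∣a-c∣<δ)
           (ℚ.*-monoʳ-<-pos A {{ℚ.positive 0<A}} ∣b-d∣<η) ⟩
    B ℚ.* δ ℚ.+ A ℚ.* η
      ≡⟨ cong₂ ℚ._+_ Bδ Aη ⟩
    ε ℚ.* ½ ℚ.+ ε ℚ.* ½
      ≡⟨ half ε ⟩
    ε ∎
    where open ℚ.≤-Reasoning

  *-cauchy : ∀ x y → IsCauchy x → IsCauchy y → IsCauchy (λ n → x n ℚ.* y n)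
  *-cauchy x y cx cy ε 0<ε =
    let 0<ε/2 = pos* 0<ε 0<½
        A , 0<A , K , hA = eventually-bounded x cx
        B , 0<B , L , hB = eventually-bounded y cy
        δ , 0<δ , Bδ = quotient B (ε ℚ.* ½) 0<B 0<ε/2
        η , 0<η , Aη = quotient A (ε ℚ.* ½) 0<A 0<ε/2
        M , hM = cx δ 0<δ
        N , hN = cy η 0<η
    in (K ℕ.⊔ L) ℕ.⊔ (M ℕ.⊔ N) , λ m n m≥ n≥ →
    *-close (x m) (y m) (x n) (y n) 0<A 0<B Aη Bδ
      (hA m (ℕ.m⊔n≤o⇒m≤o K L (ℕ.m⊔n≤o⇒m≤o (K ℕ.⊔ L) (M ℕ.⊔ N) m≥)))
      (hB n (ℕ.m⊔n≤o⇒n≤o K L (ℕ.m⊔n≤o⇒m≤o (K ℕ.⊔ L) (M ℕ.⊔ N) n≥)))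
      (hM m n (ℕ.m⊔n≤o⇒m≤o M N (ℕ.m⊔n≤o⇒n≤o (K ℕ.⊔ L) (M ℕ.⊔ N) m≥))
              (ℕ.m⊔n≤o⇒m≤o M N (ℕ.m⊔n≤o⇒n≤o (K ℕ.⊔ L) (M ℕ.⊔ N) n≥)))
      (hN m n (ℕ.m⊔n≤o⇒n≤o M N (ℕ.m⊔n≤o⇒n≤o (K ℕ.⊔ L) (M ℕ.⊔ N) m≥))
              (ℕ.m⊔n≤o⇒n≤o M N (ℕ.m⊔n≤o⇒n≤o (K ℕ.⊔ L) (M ℕ.⊔ N) n≥)))

open Cauchy-Lemmas

_+_ : ℝ → ℝ → ℝ
x + y = mkℝ (λ n → seq x n ℚ.+ seq y n) (+-cauchy (seq x) (seq y) (cauchy x) (cauchy y))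

-_ : ℝ → ℝ
- x = mkℝ (λ n → ℚ.- seq x n) (neg-cauchy (seq x) (cauchy x))

_-_ : ℝ → ℝ → ℝ
x - y = x + (- y)

_*_ : ℝ → ℝ → ℝ
x * y = mkℝ (λ n → seq x n ℚ.* seq y n) (*-cauchy (seq x) (seq y) (cauchy x) (cauchy y))

-- The n-th approximation to √x bisects n times an interval
-- [0 , ∣q∣ + 1] containing √q, where q is the n-th approximation to x, and
-- returns the lower end.  For q < 0 this is 0.

width : ℚ → ℕ → ℚ
width q zero    = ∣ q ∣ ℚ.+ 1ℚ
width q (suc n) = width q n ℚ.* ½

bisect : (q l w : ℚ) → ℚ
bisect q l w = if does ((l ℚ.+ w) ℚ.* (l ℚ.+ w) ℚ.≤? q) then l ℚ.+ w else l

lower : ℚ → ℕ → ℚ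
lower q zero    = 0ℚ
lower q (suc n) = bisect q (lower q n) (width q (suc n))

0<width : ∀ q n → 0ℚ ℚ.< width q n
0<width q zero    = nonNeg+pos (ℚ.0≤∣p∣ q) 0<1
0<width q (suc n) = pos* (0<width q n) 0<½

bisect-elim : ∀ (C : ℚ → Set) q l w →
  ((l ℚ.+ w) ℚ.* (l ℚ.+ w) ℚ.≤ q → C (l ℚ.+ w)) →
  (q ℚ.< (l ℚ.+ w) ℚ.* (l ℚ.+ w) → C l) → C (bisect q l w)
bisect-elim C q l w hi lo = go ((l ℚ.+ w) ℚ.* (l ℚ.+ w) ℚ.≤? q)
  where
    go : ∀ mid²≤?q → C (if does mid²≤?q then l ℚ.+ w else l)
    go (yes mid²≤q) = hi mid²≤q
    go (no  mid²≰q) = lo (ℚ.≰⇒> mid²≰q)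

0≤lower : ∀ q n → 0ℚ ℚ.≤ lower q n
0≤lower q zero    = ℚ.≤-refl
0≤lower q (suc n) = bisect-elim (0ℚ ℚ.≤_) q (lower q n) (width q (suc n))
  (λ _ → nonNeg+ (0≤lower q n) (ℚ.<⇒≤ (0<width q (suc n))))
  (λ _ → 0≤lower q n)

lower²≤ : ∀ q n → lower q n ≡ 0ℚ ⊎ lower q n ℚ.* lower q n ℚ.≤ q
lower²≤ q zero    = inj₁ refl
lower²≤ q (suc n) =
  bisect-elim (λ l → l ≡ 0ℚ ⊎ l ℚ.* l ℚ.≤ q) q (lower q n) (width q (suc n))
    inj₂ (λ _ → lower²≤ q n)

<upper² : ∀ q n → q ℚ.< (lower q n ℚ.+ width q n) ℚ.* (lower q n ℚ.+ width q n)
<upper² q zero = begin-strict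
  q                                               ≤⟨ p≤∣p∣ q ⟩
  a                                               <⟨ p<p+q a 0<1+a+a² ⟩
  a ℚ.+ (1ℚ ℚ.+ (a ℚ.+ a ℚ.* a))                  ≡⟨ solve 1 (λ a →
      a :+ (con 1ℚ :+ (a :+ a :* a)) :=
      (con 0ℚ :+ (a :+ con 1ℚ)) :* (con 0ℚ :+ (a :+ con 1ℚ))) refl a ⟩
  (0ℚ ℚ.+ (a ℚ.+ 1ℚ)) ℚ.* (0ℚ ℚ.+ (a ℚ.+ 1ℚ))     ∎
  where
    open ℚ.≤-Reasoning
    a = ∣ q ∣
    0≤a = ℚ.0≤∣p∣ q
    0<1+a+a² = subst (0ℚ ℚ.<_) (ℚ.+-comm (a ℚ.+ a ℚ.* a) 1ℚ)
      (nonNeg+pos (nonNeg+ 0≤a (nonNeg* 0≤a 0≤a)) 0<1)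
<upper² q (suc n) =
  bisect-elim (λ l → q ℚ.< (l ℚ.+ w) ℚ.* (l ℚ.+ w)) q (lower q n) w
    (λ _ → subst (λ u → q ℚ.< u ℚ.* u)
      (solve 2 (λ l w → l :+ w := (l :+ w :* con ½) :+ w :* con ½) refl (lower q n) (width q n))
      (<upper² q n))
    (λ q<mid² → q<mid²)
  where w = width q (suc n)

module √-Lemmas where

  ι : ℕ → ℚ
  ι zero    = 0ℚ
  ι (suc n) = 1ℚ ℚ.+ ι n

  0≤ι : ∀ n → 0ℚ ℚ.≤ ι n
  0≤ι zero    = ℚ.≤-refl
  0≤ι (suc n) = nonNeg+ (ℚ.<⇒≤ 0<1) (0≤ι n)

  ι-mono : ∀ {m n} → m ℕ.≤ n → ι m ℚ.≤ ι n
  ι-mono {n = n} ℕ.z≤n = 0≤ι n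
  ι-mono (ℕ.s≤s m≤n)   = ℚ.+-monoʳ-≤ 1ℚ (ι-mono m≤n)

  toℚᵘ-ι : ∀ n → ℚ.toℚᵘ (ι n) ℚᵘ.≃ ℚᵘ.mkℚᵘ (+ n) 0
  toℚᵘ-ι zero    = ℚᵘ.≃-refl
  toℚᵘ-ι (suc n) = ℚᵘ.≃-trans (ℚ.toℚᵘ-homo-+ 1ℚ (ι n))
    (ℚᵘ.≃-trans (ℚᵘ.+-congʳ (ℚ.toℚᵘ 1ℚ) (toℚᵘ-ι n))
      (ℚᵘ.*≡* (cong (λ k → (+ 1 ℤ.+ k) ℤ.* + 1) (ℤ.*-identityʳ (+ n)))))

  archimedean : ∀ q → ∃[ N ] q ℚ.< ι N
  archimedean q@(ℚ.mkℚ i d-1 _) = N , ℚ.toℚᵘ-cancel-< {q} {ι N}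
    (ℚᵘ.<-respʳ-≃ (ℚᵘ.≃-sym (toℚᵘ-ι N)) (ℚᵘ.*<* (begin-strict
      i ℤ.* + 1             ≡⟨ ℤ.*-identityʳ i ⟩
      i                     ≤⟨ i≤+∣i∣ i ⟩
      + ℤ.∣ i ∣             <⟨ ℤ.+<+ (ℕ.n<1+n ℤ.∣ i ∣) ⟩
      + N                   ≤⟨ ℤ.+≤+ (ℕ.m≤m*n N (suc d-1)) ⟩
      + (N ℕ.* suc d-1)     ≡⟨ ℤ.pos-* N (suc d-1) ⟩
      + N ℤ.* + suc d-1     ∎)))
    where
      open ℤ.≤-Reasoning
      N = suc ℤ.∣ i ∣
      i≤+∣i∣ : ∀ i → i ℤ.≤ + ℤ.∣ i ∣
      i≤+∣i∣ (+ _)        = ℤ.≤-refl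
      i≤+∣i∣ (ℤ.-[1+ _ ]) = ℤ.-≤+

  width*ι : ∀ q n → width q n ℚ.* ι n ℚ.≤ ∣ q ∣ ℚ.+ 1ℚ
  width≤ : ∀ q n → width q n ℚ.≤ ∣ q ∣ ℚ.+ 1ℚ

  width≤ q zero    = ℚ.≤-refl
  width≤ q (suc n) = begin
    w ℚ.* ½                ≡⟨ ℚ.+-identityʳ _ ⟨
    w ℚ.* ½ ℚ.+ 0ℚ         ≤⟨ ℚ.+-monoʳ-≤ (w ℚ.* ½) (ℚ.<⇒≤ (0<width q (suc n))) ⟩
    w ℚ.* ½ ℚ.+ w ℚ.* ½    ≡⟨ half w ⟩
    w                      ≤⟨ width≤ q n ⟩
    ∣ q ∣ ℚ.+ 1ℚ           ∎
    where
      open ℚ.≤-Reasoning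
      w = width q n

  width*ι q zero    = ℚ.≤-trans (ℚ.≤-reflexive (ℚ.*-zeroʳ (width q zero))) (ℚ.<⇒≤ (0<width q zero))
  width*ι q (suc n) = begin
    w ℚ.* ½ ℚ.* (1ℚ ℚ.+ ι n)
      ≡⟨ solve 2 (λ w k → w :* con ½ :* (con 1ℚ :+ k) :=
           (w :+ w :* k) :* con ½) refl w (ι n) ⟩
    (w ℚ.+ w ℚ.* ι n) ℚ.* ½
      ≤⟨ ℚ.*-monoʳ-≤-nonNeg ½ (ℚ.+-mono-≤ (width≤ q n) (width*ι q n)) ⟩
    (c ℚ.+ c) ℚ.* ½
      ≡⟨ solve 1 (λ c → (c :+ c) :* con ½ := c) refl c ⟩
    c ∎
    where
      open ℚ.≤-Reasoning
      w = width q n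
      c = ∣ q ∣ ℚ.+ 1ℚ

  -- The bisection widths tend to 0 uniformly over bounded q.
  width-small : ∀ B ε → 0ℚ ℚ.< B → 0ℚ ℚ.< ε →
    ∃[ N ] (∀ q n → ∣ q ∣ ℚ.≤ B → N ℕ.≤ n → width q n ℚ.< ε)
  width-small B ε 0<B 0<ε =
    let c , 0<c , εc = quotient ε (B ℚ.+ 1ℚ) 0<ε (nonNeg+pos (ℚ.<⇒≤ 0<B) 0<1)
        N , c<N      = archimedean c
        open ℚ.≤-Reasoning
    in N , λ q n q≤B N≤n → ℚ.*-cancelʳ-<-nonNeg c {{ℚ.nonNegative (ℚ.<⇒≤ 0<c)}} (begin-strict
      width q n ℚ.* c      <⟨ ℚ.*-monoʳ-<-pos (width q n) {{ℚ.positive (0<width q n)}}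
                                (ℚ.<-≤-trans c<N (ι-mono N≤n)) ⟩
      width q n ℚ.* ι n    ≤⟨ width*ι q n ⟩
      ∣ q ∣ ℚ.+ 1ℚ         ≤⟨ ℚ.+-monoˡ-≤ 1ℚ q≤B ⟩
      B ℚ.+ 1ℚ             ≡⟨ εc ⟨
      ε ℚ.* c              ∎)

  -- √a < √b + ε when a < b + (ε/2)² and √b has been found up to ε/2.
  lower-close : ∀ a b m n ε → 0ℚ ℚ.< ε →
    a ℚ.< b ℚ.+ (ε ℚ.* ½) ℚ.* (ε ℚ.* ½) → width b n ℚ.< ε ℚ.* ½ →
    lower a m ℚ.< lower b n ℚ.+ ε
  lower-close a b m n ε 0<ε a<b+δ² w<δ = case (lower²≤ a m) (<-≤-total (lower a m) (l ℚ.+ ε))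
    where
      open ℚ.≤-Reasoning
      l = lower b n
      w = width b n
      δ = ε ℚ.* ½
      0<δ = pos* 0<ε 0<½
      0≤δ = ℚ.<⇒≤ 0<δ
      0≤l = 0≤lower b n
      0≤w = ℚ.<⇒≤ (0<width b n)
      0≤l+w = nonNeg+ 0≤l 0≤w
      0≤l+δ = nonNeg+ 0≤l 0≤δ
      0≤l+ε = nonNeg+ 0≤l (ℚ.<⇒≤ 0<ε)
      l+w≤l+δ = ℚ.+-monoʳ-≤ l (ℚ.<⇒≤ w<δ)
      cross = (l ℚ.+ δ) ℚ.* (δ ℚ.+ δ)
      0≤cross = nonNeg* 0≤l+δ (nonNeg+ 0≤δ 0≤δ)
      a<a : l ℚ.+ ε ℚ.≤ lower a m → lower a m ℚ.* lower a m ℚ.≤ a → a ℚ.< a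
      a<a l+ε≤ l²≤a = begin-strict
        a                                                     <⟨ a<b+δ² ⟩
        b ℚ.+ δ ℚ.* δ                                         ≤⟨ ℚ.+-monoˡ-≤ (δ ℚ.* δ) (ℚ.<⇒≤ (<upper² b n)) ⟩
        (l ℚ.+ w) ℚ.* (l ℚ.+ w) ℚ.+ δ ℚ.* δ                   ≤⟨ ℚ.+-monoˡ-≤ (δ ℚ.* δ) (*-mono-≤ 0≤l+w 0≤l+δ l+w≤l+δ l+w≤l+δ) ⟩
        (l ℚ.+ δ) ℚ.* (l ℚ.+ δ) ℚ.+ δ ℚ.* δ                   ≡⟨ ℚ.+-identityʳ _ ⟨
        (l ℚ.+ δ) ℚ.* (l ℚ.+ δ) ℚ.+ δ ℚ.* δ ℚ.+ 0ℚ            ≤⟨ ℚ.+-monoʳ-≤ ((l ℚ.+ δ) ℚ.* (l ℚ.+ δ) ℚ.+ δ ℚ.* δ) 0≤cross ⟩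
        (l ℚ.+ δ) ℚ.* (l ℚ.+ δ) ℚ.+ δ ℚ.* δ ℚ.+ cross         ≡⟨ solve 2 (λ l ε →
            let δ = ε :* con ½ in
            (l :+ δ) :* (l :+ δ) :+ δ :* δ :+ (l :+ δ) :* (δ :+ δ) :=
            (l :+ ε) :* (l :+ ε)) refl l ε ⟩
        (l ℚ.+ ε) ℚ.* (l ℚ.+ ε)                               ≤⟨ *-mono-≤ 0≤l+ε (0≤lower a m) l+ε≤ l+ε≤ ⟩
        lower a m ℚ.* lower a m                               ≤⟨ l²≤a ⟩
        a                                                     ∎
      case : lower a m ≡ 0ℚ ⊎ lower a m ℚ.* lower a m ℚ.≤ a →
        lower a m ℚ.< l ℚ.+ ε ⊎ l ℚ.+ ε ℚ.≤ lower a m → lower a m ℚ.< l ℚ.+ ε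
      case _          (inj₁ l<l+ε) = l<l+ε
      case (inj₁ l≡0) (inj₂ _)     = subst (ℚ._< l ℚ.+ ε) (sym l≡0) (nonNeg+pos 0≤l 0<ε)
      case (inj₂ l²≤a) (inj₂ l+ε≤) = contradiction (a<a l+ε≤ l²≤a) (ℚ.<-irrefl refl)

  √-cauchy : ∀ x → IsCauchy x → IsCauchy (λ n → lower (x n) n)
  √-cauchy x cx ε 0<ε =
    let δ = ε ℚ.* ½
        0<δ = pos* 0<ε 0<½
        B , 0<B , K , hB = eventually-bounded x cx
        M , hM = width-small B δ 0<B 0<δ
        N , hN = cx (δ ℚ.* δ) (pos* 0<δ 0<δ)
        close : ∀ m n → K ℕ.⊔ (M ℕ.⊔ N) ℕ.≤ m → K ℕ.⊔ (M ℕ.⊔ N) ℕ.≤ n →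
          lower (x m) m ℚ.< lower (x n) n ℚ.+ ε
        close = λ m n m≥ n≥ → lower-close (x m) (x n) m n ε 0<ε
          (p-q<r⇒p<q+r (x m) (x n) (δ ℚ.* δ) (ℚ.≤-<-trans (p≤∣p∣ (x m ℚ.- x n)) (hN m n
            (ℕ.m⊔n≤o⇒n≤o M N (ℕ.m⊔n≤o⇒n≤o K (M ℕ.⊔ N) m≥))
            (ℕ.m⊔n≤o⇒n≤o M N (ℕ.m⊔n≤o⇒n≤o K (M ℕ.⊔ N) n≥)))))
          (hM (x n) n (hB n (ℕ.m⊔n≤o⇒m≤o K (M ℕ.⊔ N) n≥))
            (ℕ.m⊔n≤o⇒m≤o M N (ℕ.m⊔n≤o⇒n≤o K (M ℕ.⊔ N) n≥)))
    in K ℕ.⊔ (M ℕ.⊔ N) , λ m n m≥ n≥ → ∣-∣<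
      (p<q+r⇒p-q<r (lower (x m) m) (lower (x n) n) ε (close m n m≥ n≥))
      (subst (ℚ._< ε)
        (solve 2 (λ p q → q :- p := :- (p :- q)) refl (lower (x m) m) (lower (x n) n))
        (p<q+r⇒p-q<r (lower (x n) n) (lower (x m) m) ε (close n m n≥ m≥)))

open √-Lemmas

infix 8 √_

√_ : ℝ → ℝ
√ x = mkℝ (λ n → lower (seq x n) n) (√-cauchy (seq x) (cauchy x))

infix 4 _≈ₚ_

record Point : Set where
  constructor ⟨_,_⟩
  field
    xcoord ycoord : ℝ

open Point public

_≈ₚ_ : Point → Point → Set
P ≈ₚ Q = xcoord P ≈ xcoord Q × ycoord P ≈ ycoord Q

dist : Point → Point → ℝ
dist P Q = √ (Δx * Δx + Δy * Δy)
  where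
    Δx = xcoord P - xcoord Q
    Δy = ycoord P - ycoord Q

-- Z lies on the closed segment from P to Q.
OnSegment : Point → Point → Point → Set
OnSegment P Q Z = ∃[ t ] 0ℝ ≤ t × t ≤ 1ℝ ×
  Z ≈ₚ ⟨ (1ℝ - t) * xcoord P + t * xcoord Q , (1ℝ - t) * ycoord P + t * ycoord Q ⟩

record Instance (n : ℕ) : Set where
  field
    pt       : Fin n → Point
    distinct : ∀ {i j} → pt i ≈ₚ pt j → i ≡ j

open Instance public

-- A tour lists the points in cyclic order.  Tours that differ by a rotation
-- or a reversal are the same Hamiltonian cycle.  For n = 2 the tour goes
-- back and forth along the only edge.
Tour : ℕ → Set
Tour = Permutation′

next : ∀ {n} → Fin n → Fin n
next {suc n} i = suc (toℕ i) mod suc n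

tail head : ∀ {n} → Tour n → Fin n → Fin n
tail T i = T ⟨$⟩ʳ i
head T i = T ⟨$⟩ʳ next i

module _ {n : ℕ} (X : Instance n) where

  ℓ : Tour n → ℝ
  ℓ T = foldr _+_ 0ℝ λ i → dist (pt X (tail T i)) (pt X (head T i))

  OnEdge : Tour n → Fin n → Point → Set
  OnEdge T i = OnSegment (pt X (tail T i)) (pt X (head T i))

  -- Edges are unordered pairs of points.
  SameEdge : Tour n → Fin n → Fin n → Set
  SameEdge T i j = (tail T i ≡ tail T j × head T i ≡ head T j)
                 ⊎ (tail T i ≡ head T j × head T i ≡ tail T j)

  Endpoint : Tour n → Fin n → Fin n → Set
  Endpoint T i k = k ≡ tail T i ⊎ k ≡ head T i

  Noncrossing : Tour n → Set
  Noncrossing T = ∀ i j → ¬ SameEdge T i j →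
    ∀ Z → OnEdge T i Z → OnEdge T j Z →
    ∃[ k ] Endpoint T i k × Endpoint T j k × Z ≈ₚ pt X k

  Shortest : Tour n → Set
  Shortest T = ∀ T′ → ℓ T ≤ ℓ T′

  -- The approximation ratio of X-opt is the length of a longest noncrossing
  -- tour divided by that of a shortest tour.  It is at least c if and only
  -- if some noncrossing tour is at least c times as long as a shortest tour, and
  -- at most c if and only if no noncrossing tour is longer than c times that.
  -- Finding a minimum of finitely many reals is not constructive, so shortest
  -- tours are quantified over rather than computed.

  RatioAtLeast : ℝ → Set
  RatioAtLeast c = ∃[ T ] Noncrossing T × (∀ T* → Shortest T* → c * ℓ T* ≤ ℓ T)

  RatioAtMost : ℝ → Set
  RatioAtMost c = ∀ T → Noncrossing T → ∀ T* → Shortest T* → ℓ T ≤ c * ℓ T*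

{-# OPTIONS --safe #-}

-- Put n/2 points Lᵢ very close to (0 , 0) and n/2 points Rᵢ very close to
-- (1 , 0).  Every tour has length at most about n, and at least 2 because of
-- its horizontal variation; visiting all the Lᵢ before the Rᵢ gives a tour of
-- length about 2.  With the Lᵢ on the y-axis and the Rᵢ on the x-axis,
-- ordered outwards except that L₀ is below the x-axis, the alternating
-- tour L₀ R₀ L₁ R₁ … of length at least n is noncrossing: all vertices visited
-- before an edge lie strictly on one side of its line, apart from its endpoints.
module Submission where

open import Defs
open import Data.Integer using (+_)
open import Data.Nat using (ℕ)
open import Data.Nat.Divisibility using (_∣_)
open import Data.Product using (∃-syntax; _×_)
open import Data.Rational using (_/_)

import Algebra.Properties.CommutativeMonoid.Sum as Sum
open import Data.Empty using (⊥; ⊥-elim)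
open import Data.Fin as Fin using (Fin; zero; suc; toℕ; fromℕ; inject₁; combine; remQuot)
open import Data.Fin.Permutation as Perm using (_⟨$⟩ʳ_; _⟨$⟩ˡ_; _∘ₚ_)
import Data.Fin.Properties as Fin
open import Data.Fin.Relation.Unary.Top using (view; ‵fromℕ; ‵inj₁)
import Data.Integer.Properties as ℤ
open import Data.Nat as ℕ using (zero; suc)
open import Data.Nat.Divisibility using (divides)
import Data.Nat.DivMod as ℕ
import Data.Nat.Properties as ℕ
open import Data.Product using (_,_; proj₁; proj₂; uncurry)
open import Data.Product.Algebra using (×-comm)
open import Data.Rational as ℚ using (ℚ; 0ℚ; 1ℚ; ½)
import Data.Rational.Properties as ℚ
open import Data.Rational.Solver using (module +-*-Solver)
import Data.Rational.Unnormalised as ℚᵘ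
import Data.Rational.Unnormalised.Properties as ℚᵘ
open import Data.Sum using (_⊎_; inj₁; inj₂)
open import Data.Vec.Functional using (foldr)
open import Function using (_∘_)
open import Function.Properties.Inverse using (↔-sym; ↔-trans)
open import Relation.Binary using (tri<; tri≈; tri>)
open import Relation.Binary.PropositionalEquality
open import Relation.Nullary using (¬_; yes; no; contradiction)

open +-*-Solver using (solve; _:+_; _:*_; _:-_; :-_; _:=_; con)
open ℚ-Lemmas
open Cauchy-Lemmas using (quotient)
open √-Lemmas using (ι; 0≤ι; ι-mono; toℚᵘ-ι; width-small)
open Sum ℚ.+-0-commutativeMonoid using (sum; sum-cong-≗; sum-init-last; ∑-distrib-+)

-- The vertices have rational coordinates, so comparisons between them are decidable. Tour lengths,
-- the factor `c`, and a common point `Z` with its segment parameters are Cauchy reals, for which no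
-- case distinction such as t = 0 or t > 0 is available. This obstacle shapes both halves of the
-- proof. Lengths are compared with rational numbers only: a distance lies between |Δx| and |Δx| +
-- |Δy|, so no two square roots are ever compared. For crossings, the supporting functional of the
-- later edge turns a common point into a combination of the weights 1 - t and t that tends to 0 and
-- has nonnegative rational coefficients; a weight with positive coefficient must then tend to 0
-- itself. Which coefficients are positive depends on indices alone and can be decided. A shortest
-- tour is never exhibited: its length is only squeezed between 2 and the length of a tour that
-- visits one cluster after the other.

-- Inequalities and absolute values over the rationals

≤-by-gap : ∀ {p q} d → 0ℚ ℚ.≤ d → p ℚ.+ d ≡ q → p ℚ.≤ q
≤-by-gap {p} d 0≤d eq = subst₂ ℚ._≤_ (ℚ.+-identityʳ p) eq (ℚ.+-monoʳ-≤ p 0≤d)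

<-by-gap : ∀ {p q} d → 0ℚ ℚ.< d → p ℚ.+ d ≡ q → p ℚ.< q
<-by-gap {p} d 0<d eq = subst (p ℚ.<_) eq (p<p+q p 0<d)

-- Turns a hypothesis into a nonnegative term. A polynomial inequality is then proved by feeding a
-- sum of products of such terms to `≤-by-gap`, which leaves a ring identity for `solve`.
gap-≤ : ∀ {p q} → p ℚ.≤ q → 0ℚ ℚ.≤ q ℚ.- p
gap-≤ {p} {q} p≤q = subst (ℚ._≤ q ℚ.- p) (ℚ.+-inverseʳ p) (ℚ.+-monoˡ-≤ (ℚ.- p) p≤q)

gap-< : ∀ {p q} → p ℚ.< q → 0ℚ ℚ.< q ℚ.- p
gap-< {p} {q} p<q = subst (ℚ._< q ℚ.- p) (ℚ.+-inverseʳ p) (ℚ.+-monoˡ-< (ℚ.- p) p<q)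

∣-∣≤ : ∀ {p r} → p ℚ.≤ r → ℚ.- p ℚ.≤ r → ℚ.∣ p ∣ ℚ.≤ r
∣-∣≤ {p} p≤r -p≤r with ℚ.∣p∣≡p∨∣p∣≡-p p
... | inj₁ eq = subst (ℚ._≤ _) (sym eq) p≤r
... | inj₂ eq = subst (ℚ._≤ _) (sym eq) -p≤r

∣-∣-triangle : ∀ p q r → ℚ.∣ p ℚ.- r ∣ ℚ.≤ ℚ.∣ p ℚ.- q ∣ ℚ.+ ℚ.∣ q ℚ.- r ∣
∣-∣-triangle p q r = subst (ℚ._≤ ℚ.∣ p ℚ.- q ∣ ℚ.+ ℚ.∣ q ℚ.- r ∣)
  (cong ℚ.∣_∣ (solve 3 (λ p q r → (p :- q) :+ (q :- r) := p :- r) refl p q r))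
  (ℚ.∣p+q∣≤∣p∣+∣q∣ (p ℚ.- q) (q ℚ.- r))

∣-∣² : ∀ p → ℚ.∣ p ∣ ℚ.* ℚ.∣ p ∣ ≡ p ℚ.* p
∣-∣² p with ℚ.∣p∣≡p∨∣p∣≡-p p
... | inj₁ eq = cong₂ ℚ._*_ eq eq
... | inj₂ eq = trans (cong₂ ℚ._*_ eq eq) (solve 1 (λ p → (:- p) :* (:- p) := p :* p) refl p)

²-cancel-≤ : ∀ {p q} → 0ℚ ℚ.≤ q → p ℚ.* p ℚ.≤ q ℚ.* q → p ℚ.≤ q
²-cancel-≤ {p} {q} 0≤q p²≤q² with <-≤-total q p
... | inj₂ p≤q = p≤q
... | inj₁ q<p = contradiction (ℚ.≤-<-trans
  (ℚ.*-monoˡ-≤-nonNeg q {{ℚ.nonNegative 0≤q}} (ℚ.<⇒≤ q<p))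
  (ℚ.*-monoˡ-<-pos p {{ℚ.positive (ℚ.≤-<-trans 0≤q q<p)}} q<p))
  (λ q²<p² → ℚ.<-irrefl refl (ℚ.<-≤-trans q²<p² p²≤q²))

-- Finite sums

sum-mono : ∀ {n} {f g : Fin n → ℚ} → (∀ i → f i ℚ.≤ g i) → sum f ℚ.≤ sum g
sum-mono {zero}  f≤g = ℚ.≤-refl
sum-mono {suc n} f≤g = ℚ.+-mono-≤ (f≤g zero) (sum-mono (f≤g ∘ suc))

sum-const : ∀ n c → sum {n} (λ _ → c) ≡ ι n ℚ.* c
sum-const zero    c = sym (ℚ.*-zeroˡ c)
sum-const (suc n) c = trans (cong (c ℚ.+_) (sum-const n c))
  (solve 2 (λ c k → c :+ k :* c := (con 1ℚ :+ k) :* c) refl c (ι n))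

Σ : ∀ {n} → (Fin n → ℝ) → ℝ
Σ = foldr _+_ 0ℝ

seq-Σ : ∀ {n} (f : Fin n → ℝ) m → seq (Σ f) m ≡ sum (λ i → seq (f i) m)
seq-Σ {zero}  f m = refl
seq-Σ {suc n} f m = cong (seq (f zero) m ℚ.+_) (seq-Σ (f ∘ suc) m)

fromℚ-+-mono-≤ : ∀ p q {x y} → fromℚ p ≤ x → fromℚ q ≤ y → fromℚ (p ℚ.+ q) ≤ x + y
fromℚ-+-mono-≤ p q {x} {y} p≤x q≤y ε 0<ε
  with p≤x (ε ℚ.* ½) (pos* 0<ε 0<½) | q≤y (ε ℚ.* ½) (pos* 0<ε 0<½)
... | M , hM | N , hN = M ℕ.⊔ N , λ n n≥ → begin
  p ℚ.+ q
    ≤⟨ ℚ.+-mono-≤ (hM n (ℕ.m⊔n≤o⇒m≤o M N n≥)) (hN n (ℕ.m⊔n≤o⇒n≤o M N n≥)) ⟩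
  (seq x n ℚ.+ ε ℚ.* ½) ℚ.+ (seq y n ℚ.+ ε ℚ.* ½)
    ≡⟨ solve 3 (λ a b ε → (a :+ ε :* con ½) :+ (b :+ ε :* con ½) := (a :+ b) :+ ε)
         refl (seq x n) (seq y n) ε ⟩
  (seq x n ℚ.+ seq y n) ℚ.+ ε ∎
  where open ℚ.≤-Reasoning

fromℚ-mono-≤ : ∀ {p q} → p ℚ.≤ q → fromℚ p ≤ fromℚ q
fromℚ-mono-≤ p≤q ε 0<ε = 0 , λ _ _ → ℚ.≤-trans p≤q (ℚ.<⇒≤ (p<p+q _ 0<ε))

fromℚ-≤-trans : ∀ {p q x} → p ℚ.≤ q → fromℚ q ≤ x → fromℚ p ≤ x
fromℚ-≤-trans p≤q q≤x ε 0<ε with q≤x ε 0<ε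
... | N , h = N , λ n n≥ → ℚ.≤-trans p≤q (h n n≥)

Σ-lower : ∀ {n} {g : Fin n → ℚ} {f : Fin n → ℝ} → (∀ i → fromℚ (g i) ≤ f i) →
  fromℚ (sum g) ≤ Σ f
Σ-lower {zero}              g≤f = fromℚ-mono-≤ ℚ.≤-refl
Σ-lower {suc n} {g} {f} g≤f =
  fromℚ-+-mono-≤ (g zero) (sum (g ∘ suc)) {f zero} {Σ (f ∘ suc)} (g≤f zero) (Σ-lower (g≤f ∘ suc))

Σ-upper : ∀ {n} {g : Fin n → ℚ} {f : Fin n → ℝ} m → (∀ i → seq (f i) m ℚ.≤ g i) →
  seq (Σ f) m ℚ.≤ sum g
Σ-upper {f = f} m f≤g = ℚ.≤-trans (ℚ.≤-reflexive (seq-Σ f m)) (sum-mono f≤g)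

Σ-nonNeg : ∀ {n} {f : Fin n → ℝ} m → (∀ i → 0ℚ ℚ.≤ seq (f i) m) → 0ℚ ℚ.≤ seq (Σ f) m
Σ-nonNeg {zero}  m 0≤f = ℚ.≤-refl
Σ-nonNeg {suc n} m 0≤f = nonNeg+ (0≤f zero) (Σ-nonNeg m (0≤f ∘ suc))

-- Distances between rational points

-- Bisection returns lower ends of intervals, so an upper bound on a square root already holds for
-- every approximation and not just in the limit.
lower-upper : ∀ {q D} m → 0ℚ ℚ.≤ D → q ℚ.≤ D ℚ.* D → lower q m ℚ.≤ D
lower-upper {q} m 0≤D q≤D² with lower²≤ q m
... | inj₁ l≡0  = subst (ℚ._≤ _) (sym l≡0) 0≤D
... | inj₂ l²≤q = ²-cancel-≤ 0≤D (ℚ.≤-trans l²≤q q≤D²)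

-- Only the upper end of the bisection interval is known to exceed `D`; the lower end falls short by
-- at most the width, which eventually drops below `ε`.
≤√ : ∀ {q D} → D ℚ.* D ℚ.≤ q → fromℚ D ≤ √ fromℚ q
≤√ {q} {D} D²≤q ε 0<ε with width-small (ℚ.∣ q ∣ ℚ.+ 1ℚ) ε (nonNeg+pos (ℚ.0≤∣p∣ q) 0<1) 0<ε
... | N , h = N , λ n n≥ → ℚ.≤-trans
  (²-cancel-≤ (nonNeg+ (0≤lower q n) (ℚ.<⇒≤ (0<width q n)))
    (ℚ.≤-trans D²≤q (ℚ.<⇒≤ (<upper² q n))))
  (ℚ.+-monoʳ-≤ (lower q n) (ℚ.<⇒≤ (h q n (ℚ.<⇒≤ (p<p+q ℚ.∣ q ∣ 0<1)) n≥)))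

ℚ² : Set
ℚ² = ℚ × ℚ

point : ℚ² → Point
point (x , y) = ⟨ fromℚ x , fromℚ y ⟩

-- The Euclidean norm is at most the taxicab norm, because (s + t)² exceeds s² + t² by 2st.
dist-upper : ∀ u v m {D} →
  ℚ.∣ proj₁ u ℚ.- proj₁ v ∣ ℚ.+ ℚ.∣ proj₂ u ℚ.- proj₂ v ∣ ℚ.≤ D →
  seq (dist (point u) (point v)) m ℚ.≤ D
dist-upper u v m ≤D = ℚ.≤-trans (lower-upper m 0≤s (≤-by-gap (s ℚ.* t ℚ.+ s ℚ.* t)
    (nonNeg+ 0≤st 0≤st) (trans
      (cong (ℚ._+ (s ℚ.* t ℚ.+ s ℚ.* t)) (sym (cong₂ ℚ._+_ (∣-∣² Δx) (∣-∣² Δy))))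
      (solve 2 (λ s t → (s :* s :+ t :* t) :+ (s :* t :+ s :* t) := (s :+ t) :* (s :+ t))
        refl s t)))) ≤D
  where
    Δx = proj₁ u ℚ.- proj₁ v
    Δy = proj₂ u ℚ.- proj₂ v
    s = ℚ.∣ Δx ∣
    t = ℚ.∣ Δy ∣
    0≤s  = nonNeg+ (ℚ.0≤∣p∣ Δx) (ℚ.0≤∣p∣ Δy)
    0≤st = nonNeg* (ℚ.0≤∣p∣ Δx) (ℚ.0≤∣p∣ Δy)

dist-lower : ∀ u v → fromℚ ℚ.∣ proj₁ u ℚ.- proj₁ v ∣ ≤ dist (point u) (point v)
dist-lower (a , b) (c , d) = ≤√ {Δx ℚ.* Δx ℚ.+ Δy ℚ.* Δy} {ℚ.∣ Δx ∣} (≤-by-gap (Δy ℚ.* Δy)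
  (subst (0ℚ ℚ.≤_) (∣-∣² Δy) (nonNeg* (ℚ.0≤∣p∣ Δy) (ℚ.0≤∣p∣ Δy)))
  (cong (ℚ._+ Δy ℚ.* Δy) (∣-∣² Δx)))
  where
    Δx = a ℚ.- c
    Δy = b ℚ.- d

-- Variation along a cycle

next-suc : ∀ {n} {p q : Fin n} → toℕ q ≡ suc (toℕ p) → next p ≡ q
next-suc {suc n} {p} {q} q≡1+p = Fin.toℕ-injective (trans (Fin.toℕ-fromℕ< _)
  (trans (ℕ.m<n⇒m%n≡m (subst (ℕ._< suc n) q≡1+p (Fin.toℕ<n q))) (sym q≡1+p)))

next-last : ∀ {n} {p : Fin (suc n)} → toℕ p ≡ n → next p ≡ zero
next-last {n} {p} p≡n = Fin.toℕ-injective (trans (Fin.toℕ-fromℕ< _)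
  (trans (cong (λ k → suc k ℕ.% suc n) p≡n) (ℕ.n%n≡0 (suc n))))

next-inject₁ : ∀ {n} (i : Fin n) → next (inject₁ i) ≡ suc i
next-inject₁ i = next-suc (cong suc (sym (Fin.toℕ-inject₁ i)))

next-fromℕ : ∀ n → next (fromℕ n) ≡ zero
next-fromℕ n = next-last (Fin.toℕ-fromℕ n)

variation : ∀ {n} → (Fin n → ℚ) → ℚ
variation f = sum (λ i → ℚ.∣ f i ℚ.- f (next i) ∣)

path-variation : ∀ {n} → (Fin (suc n) → ℚ) → ℚ
path-variation f = sum (λ i → ℚ.∣ f (inject₁ i) ℚ.- f (suc i) ∣)

variation-split : ∀ {n} (f : Fin (suc n) → ℚ) →
  variation f ≡ path-variation f ℚ.+ ℚ.∣ f (fromℕ n) ℚ.- f zero ∣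
variation-split {n} f = trans (sum-init-last (λ i → ℚ.∣ f i ℚ.- f (next i) ∣)) (cong₂ ℚ._+_
  (sum-cong-≗ λ i → cong (λ j → ℚ.∣ f (inject₁ i) ℚ.- f j ∣) (next-inject₁ i))
  (cong (λ j → ℚ.∣ f (fromℕ n) ℚ.- f j ∣) (next-fromℕ n)))

path-ends : ∀ {n} (f : Fin (suc n) → ℚ) → ℚ.∣ f zero ℚ.- f (fromℕ n) ∣ ℚ.≤ path-variation f
path-ends {zero}  f = ℚ.≤-reflexive (cong ℚ.∣_∣ (ℚ.+-inverseʳ (f zero)))
path-ends {suc n} f = ℚ.≤-trans (∣-∣-triangle (f zero) (f (suc zero)) (f (fromℕ (suc n))))
  (ℚ.+-monoʳ-≤ ℚ.∣ f zero ℚ.- f (suc zero) ∣ (path-ends (f ∘ suc)))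

path-through : ∀ {n} (f : Fin (suc n) → ℚ) a →
  ℚ.∣ f zero ℚ.- f a ∣ ℚ.+ ℚ.∣ f a ℚ.- f (fromℕ n) ∣ ℚ.≤ path-variation f
path-through {n}     f zero    = begin
  ℚ.∣ f zero ℚ.- f zero ∣ ℚ.+ e    ≡⟨ cong (λ d → ℚ.∣ d ∣ ℚ.+ e) (ℚ.+-inverseʳ (f zero)) ⟩
  0ℚ ℚ.+ e                         ≡⟨ ℚ.+-identityˡ e ⟩
  e                                ≤⟨ path-ends f ⟩
  path-variation f                 ∎
  where
    open ℚ.≤-Reasoning
    e = ℚ.∣ f zero ℚ.- f (fromℕ n) ∣
path-through {suc n} f (suc a) = begin
  ℚ.∣ f zero ℚ.- f (suc a) ∣ ℚ.+ e
    ≤⟨ ℚ.+-monoˡ-≤ e (∣-∣-triangle (f zero) (f (suc zero)) (f (suc a))) ⟩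
  (c ℚ.+ ℚ.∣ f (suc zero) ℚ.- f (suc a) ∣) ℚ.+ e
    ≡⟨ ℚ.+-assoc c _ e ⟩
  c ℚ.+ (ℚ.∣ f (suc zero) ℚ.- f (suc a) ∣ ℚ.+ e)
    ≤⟨ ℚ.+-monoʳ-≤ c (path-through (f ∘ suc) a) ⟩
  path-variation f ∎
  where
    open ℚ.≤-Reasoning
    c = ℚ.∣ f zero ℚ.- f (suc zero) ∣
    e = ℚ.∣ f (suc a) ℚ.- f (fromℕ (suc n)) ∣

path-through₂ : ∀ {n} (f : Fin (suc n) → ℚ) {a b} → a Fin.≤ b →
  ℚ.∣ f zero ℚ.- f a ∣ ℚ.+ (ℚ.∣ f a ℚ.- f b ∣ ℚ.+ ℚ.∣ f b ℚ.- f (fromℕ n) ∣) ℚ.≤ path-variation f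
path-through₂ {n} f {zero} {b} _ = begin
  ℚ.∣ f zero ℚ.- f zero ∣ ℚ.+ e    ≡⟨ cong (λ d → ℚ.∣ d ∣ ℚ.+ e) (ℚ.+-inverseʳ (f zero)) ⟩
  0ℚ ℚ.+ e                         ≡⟨ ℚ.+-identityˡ e ⟩
  e                                ≤⟨ path-through f b ⟩
  path-variation f                 ∎
  where
    open ℚ.≤-Reasoning
    e = ℚ.∣ f zero ℚ.- f b ∣ ℚ.+ ℚ.∣ f b ℚ.- f (fromℕ n) ∣
path-through₂ {suc n} f {suc a} {suc b} (ℕ.s≤s a≤b) = begin
  ℚ.∣ f zero ℚ.- f (suc a) ∣ ℚ.+ e
    ≤⟨ ℚ.+-monoˡ-≤ e (∣-∣-triangle (f zero) (f (suc zero)) (f (suc a))) ⟩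
  (c ℚ.+ ℚ.∣ f (suc zero) ℚ.- f (suc a) ∣) ℚ.+ e
    ≡⟨ ℚ.+-assoc c _ e ⟩
  c ℚ.+ (ℚ.∣ f (suc zero) ℚ.- f (suc a) ∣ ℚ.+ e)
    ≤⟨ ℚ.+-monoʳ-≤ c (path-through₂ (f ∘ suc) a≤b) ⟩
  path-variation f ∎
  where
    open ℚ.≤-Reasoning
    c = ℚ.∣ f zero ℚ.- f (suc zero) ∣
    e = ℚ.∣ f (suc a) ℚ.- f (suc b) ∣ ℚ.+ ℚ.∣ f (suc b) ℚ.- f (fromℕ (suc n)) ∣

-- The positions `a` and `b` cut the cycle into two arcs, and each arc varies by at least the
-- difference of its end values.
variation-lower-≤ : ∀ {n} (f : Fin (suc n) → ℚ) {a b} → a Fin.≤ b →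
  ℚ.∣ f a ℚ.- f b ∣ ℚ.+ ℚ.∣ f a ℚ.- f b ∣ ℚ.≤ variation f
variation-lower-≤ {n} f {a} {b} a≤b = begin
  d ℚ.+ d
    ≤⟨ ℚ.+-monoʳ-≤ d back ⟩
  d ℚ.+ ((r ℚ.+ s) ℚ.+ t)
    ≡⟨ solve 4 (λ d r s t → d :+ ((r :+ s) :+ t) := (t :+ (d :+ r)) :+ s) refl d r s t ⟩
  (t ℚ.+ (d ℚ.+ r)) ℚ.+ s
    ≤⟨ ℚ.+-monoˡ-≤ s (path-through₂ f a≤b) ⟩
  path-variation f ℚ.+ s
    ≡⟨ variation-split f ⟨
  variation f ∎
  where
    open ℚ.≤-Reasoning
    d = ℚ.∣ f a ℚ.- f b ∣
    r = ℚ.∣ f b ℚ.- f (fromℕ n) ∣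
    s = ℚ.∣ f (fromℕ n) ℚ.- f zero ∣
    t = ℚ.∣ f zero ℚ.- f a ∣
    -- The second arc runs from `b` to the last position, wraps around to `zero`, and continues to
    -- `a`.
    back : d ℚ.≤ (r ℚ.+ s) ℚ.+ t
    back = begin
      d                                    ≡⟨ ∣p-q∣≡∣q-p∣ (f a) (f b) ⟩
      ℚ.∣ f b ℚ.- f a ∣                    ≤⟨ ∣-∣-triangle (f b) (f zero) (f a) ⟩
      ℚ.∣ f b ℚ.- f zero ∣ ℚ.+ t           ≤⟨ ℚ.+-monoˡ-≤ t (∣-∣-triangle (f b) (f (fromℕ n)) (f zero)) ⟩
      (r ℚ.+ s) ℚ.+ t                      ∎

variation-lower : ∀ {n} (f : Fin n → ℚ) a b →
  ℚ.∣ f a ℚ.- f b ∣ ℚ.+ ℚ.∣ f a ℚ.- f b ∣ ℚ.≤ variation f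
variation-lower {suc n} f a b with Fin.≤-total a b
... | inj₁ a≤b = variation-lower-≤ f a≤b
... | inj₂ b≤a = subst (λ d → d ℚ.+ d ℚ.≤ variation f) (∣p-q∣≡∣q-p∣ (f b) (f a))
                   (variation-lower-≤ f b≤a)

path-variation-monotone : ∀ {n} (f : Fin (suc n) → ℚ) → (∀ i → f (inject₁ i) ℚ.≤ f (suc i)) →
  path-variation f ≡ f (fromℕ n) ℚ.- f zero
path-variation-monotone {zero}  f mono = sym (ℚ.+-inverseʳ (f zero))
path-variation-monotone {suc n} f mono = trans (cong₂ ℚ._+_
  (trans (∣p-q∣≡∣q-p∣ (f zero) (f (suc zero))) (ℚ.0≤p⇒∣p∣≡p (gap-≤ (mono zero))))
  (path-variation-monotone (f ∘ suc) (mono ∘ suc)))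
  (solve 3 (λ a b c → (b :- a) :+ (c :- b) := c :- a) refl (f zero) (f (suc zero)) (f (fromℕ (suc n))))

-- The path telescopes to its total rise, and the closing step undoes that rise at once.
variation-monotone : ∀ {n} (f : Fin (suc n) → ℚ) → (∀ {i j} → i Fin.≤ j → f i ℚ.≤ f j) →
  variation f ≡ (f (fromℕ n) ℚ.- f zero) ℚ.+ (f (fromℕ n) ℚ.- f zero)
variation-monotone {n} f mono = trans (variation-split f) (cong₂ ℚ._+_
  (path-variation-monotone f λ i → mono (ℕ.≤-trans (ℕ.≤-reflexive (Fin.toℕ-inject₁ i)) (ℕ.n≤1+n _)))
  (ℚ.0≤p⇒∣p∣≡p (gap-≤ (mono {zero} {fromℕ n} ℕ.z≤n))))

-- Null sequences

-- `x ≈ y` unfolds to `Null` of the termwise difference, so equalities of reals serve directly as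
-- null sequences.
Null : (ℕ → ℚ) → Set
Null s = ∀ ε → 0ℚ ℚ.< ε → ∃[ N ] (∀ n → N ℕ.≤ n → ℚ.∣ s n ∣ ℚ.< ε)

null-cong : ∀ {s t} → (∀ n → s n ≡ t n) → Null s → Null t
null-cong s≗t s→0 ε 0<ε with s→0 ε 0<ε
... | N , h = N , λ n n≥ → subst (λ a → ℚ.∣ a ∣ ℚ.< ε) (s≗t n) (h n n≥)

null-+ : ∀ {s t} → Null s → Null t → Null (λ n → s n ℚ.+ t n)
null-+ {s} {t} s→0 t→0 ε 0<ε with s→0 (ε ℚ.* ½) (pos* 0<ε 0<½) | t→0 (ε ℚ.* ½) (pos* 0<ε 0<½)
... | M , hM | N , hN = M ℕ.⊔ N , λ n n≥ → ℚ.≤-<-trans (ℚ.∣p+q∣≤∣p∣+∣q∣ (s n) (t n))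
  (subst (ℚ.∣ s n ∣ ℚ.+ ℚ.∣ t n ∣ ℚ.<_) (half ε)
    (ℚ.+-mono-< (hM n (ℕ.m⊔n≤o⇒m≤o M N n≥)) (hN n (ℕ.m⊔n≤o⇒n≤o M N n≥))))

null-* : ∀ c {s} → Null s → Null (λ n → c ℚ.* s n)
null-* c {s} s→0 ε 0<ε =
  -- Adding 1 keeps the divisor positive when `c` is 0.
  let B = ℚ.∣ c ∣ ℚ.+ 1ℚ
      0<B = nonNeg+pos (ℚ.0≤∣p∣ c) 0<1
      δ , 0<δ , Bδ = quotient B ε 0<B 0<ε
      N , h = s→0 δ 0<δ
      open ℚ.≤-Reasoning
  in N , λ n n≥ → begin-strict
    ℚ.∣ c ℚ.* s n ∣          ≡⟨ ℚ.∣p*q∣≡∣p∣*∣q∣ c (s n) ⟩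
    ℚ.∣ c ∣ ℚ.* ℚ.∣ s n ∣    ≤⟨ ℚ.*-monoʳ-≤-nonNeg ℚ.∣ s n ∣ {{ℚ.∣-∣-nonNeg (s n)}}
                                  (ℚ.<⇒≤ (p<p+q ℚ.∣ c ∣ 0<1)) ⟩
    B ℚ.* ℚ.∣ s n ∣          <⟨ ℚ.*-monoʳ-<-pos B {{ℚ.positive 0<B}} (h n n≥) ⟩
    B ℚ.* δ                  ≡⟨ Bδ ⟩
    ε                        ∎

null-const : ∀ {q} → Null (λ _ → q) → q ≡ 0ℚ
null-const {q} q→0 with <-≤-total 0ℚ ℚ.∣ q ∣
... | inj₁ 0<∣q∣ = contradiction (proj₂ (q→0 ℚ.∣ q ∣ 0<∣q∣) _ ℕ.≤-refl) (ℚ.<-irrefl refl)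
... | inj₂ ∣q∣≤0 = ℚ.∣p∣≡0⇒p≡0 q (ℚ.≤-antisym ∣q∣≤0 (ℚ.0≤∣p∣ q))

-- `0ℝ ≤ t` unfolds to `NonNegLimit (seq t)`; single terms may still be negative.
NonNegLimit : (ℕ → ℚ) → Set
NonNegLimit s = ∀ ε → 0ℚ ℚ.< ε → ∃[ N ] (∀ n → N ℕ.≤ n → 0ℚ ℚ.≤ s n ℚ.+ ε)

-- Up to small errors both summands are nonnegative, so neither can cancel the other, and `u > 0`
-- lets the first be divided out. This replaces the classical remark that a vanishing sum of
-- nonnegative numbers has vanishing terms.
null-summand : ∀ {s t u v} → 0ℚ ℚ.< u → 0ℚ ℚ.≤ v → NonNegLimit s → NonNegLimit t →
  Null (λ n → u ℚ.* s n ℚ.+ v ℚ.* t n) → Null s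
null-summand {s} {t} {u} {v} 0<u 0≤v 0≤s 0≤t us+vt→0 ε 0<ε =
  -- One `δ` pays for the distance of the sum from 0, and `v` times `δ` for the possible negativity
  -- of `t`.
  let δ , 0<δ , eq = quotient (1ℚ ℚ.+ v) (u ℚ.* ε)
        (subst (0ℚ ℚ.<_) (ℚ.+-comm v 1ℚ) (nonNeg+pos 0≤v 0<1)) (pos* 0<u 0<ε)
      K , hK = 0≤s (ε ℚ.* ½) (pos* 0<ε 0<½)
      M , hM = 0≤t δ 0<δ
      N , hN = us+vt→0 δ 0<δ
      open ℚ.≤-Reasoning
      s<ε : ∀ n → M ℕ.≤ n → N ℕ.≤ n → s n ℚ.< ε
      s<ε = λ n M≤n N≤n → ℚ.*-cancelˡ-<-nonNeg u {{ℚ.nonNegative (ℚ.<⇒≤ 0<u)}} (begin-strict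
        u ℚ.* s n
          ≤⟨ ≤-by-gap (v ℚ.* (t n ℚ.+ δ)) (nonNeg* 0≤v (hM n M≤n)) refl ⟩
        u ℚ.* s n ℚ.+ v ℚ.* (t n ℚ.+ δ)
          ≡⟨ solve 5 (λ u s v t δ → u :* s :+ v :* (t :+ δ) := (u :* s :+ v :* t) :+ v :* δ)
               refl u (s n) v (t n) δ ⟩
        (u ℚ.* s n ℚ.+ v ℚ.* t n) ℚ.+ v ℚ.* δ
          <⟨ ℚ.+-monoˡ-< (v ℚ.* δ) (ℚ.≤-<-trans (p≤∣p∣ _) (hN n N≤n)) ⟩
        δ ℚ.+ v ℚ.* δ
          ≡⟨ solve 2 (λ v δ → δ :+ v :* δ := (con 1ℚ :+ v) :* δ) refl v δ ⟩
        (1ℚ ℚ.+ v) ℚ.* δ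
          ≡⟨ eq ⟩
        u ℚ.* ε ∎)
      -s<ε : ∀ n → K ℕ.≤ n → ℚ.- s n ℚ.< ε
      -s<ε = λ n K≤n → <-by-gap ((s n ℚ.+ ε ℚ.* ½) ℚ.+ ε ℚ.* ½)
        (nonNeg+pos (hK n K≤n) (pos* 0<ε 0<½))
        (solve 2 (λ s ε → :- s :+ ((s :+ ε :* con ½) :+ ε :* con ½) := ε) refl (s n) ε)
  in K ℕ.⊔ (M ℕ.⊔ N) , λ n n≥ →
    let n≥′ = ℕ.m⊔n≤o⇒n≤o K (M ℕ.⊔ N) n≥ in
    ∣-∣< (s<ε n (ℕ.m⊔n≤o⇒m≤o M N n≥′) (ℕ.m⊔n≤o⇒n≤o M N n≥′)) (-s<ε n (ℕ.m⊔n≤o⇒m≤o K (M ℕ.⊔ N) n≥))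

-- Crossings of rational segments

point-injective : ∀ {u v} → point u ≈ₚ point v → u ≡ v
point-injective (x≈ , y≈) = cong₂ _,_ (equal x≈) (equal y≈)
  where
    equal : ∀ {p q} → Null (λ _ → p ℚ.- q) → p ≡ q
    equal {p} {q} h = trans (solve 2 (λ p q → p := (p :- q) :+ q) refl p q)
      (trans (cong (ℚ._+ q) (null-const h)) (ℚ.+-identityˡ q))

linear : ℚ² → ℚ² → ℚ
linear (a , b) (x , y) = a ℚ.* x ℚ.+ b ℚ.* y

near-start : ∀ (u v : ℚ²) Z t → Null (seq t) →
  Z ≈ₚ ⟨ (1ℝ - t) * fromℚ (proj₁ u) + t * fromℚ (proj₁ v)
       , (1ℝ - t) * fromℚ (proj₂ u) + t * fromℚ (proj₂ v) ⟩ → Z ≈ₚ point u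
near-start (a , b) (c , d) Z t t→0 (x≈ , y≈) =
  coord (xcoord Z) a c x≈ , coord (ycoord Z) b d y≈
  where
    coord : ∀ z p q → z ≈ (1ℝ - t) * fromℚ p + t * fromℚ q → z ≈ fromℚ p
    coord z p q z≈ = null-cong
      (λ n → solve 4 (λ z t p q → (z :- ((con 1ℚ :- t) :* p :+ t :* q)) :+ (q :- p) :* t := z :- p)
        refl (seq z n) (seq t n) p q)
      (null-+ z≈ (null-* (q ℚ.- p) t→0))

near-end : ∀ (u v : ℚ²) Z t → Null (λ n → 1ℚ ℚ.- seq t n) →
  Z ≈ₚ ⟨ (1ℝ - t) * fromℚ (proj₁ u) + t * fromℚ (proj₁ v)
       , (1ℝ - t) * fromℚ (proj₂ u) + t * fromℚ (proj₂ v) ⟩ → Z ≈ₚ point v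
near-end (a , b) (c , d) Z t 1-t→0 (x≈ , y≈) =
  coord (xcoord Z) a c x≈ , coord (ycoord Z) b d y≈
  where
    coord : ∀ z p q → z ≈ (1ℝ - t) * fromℚ p + t * fromℚ q → z ≈ fromℚ q
    coord z p q z≈ = null-cong
      (λ n → solve 4 (λ z t p q →
          (z :- ((con 1ℚ :- t) :* p :+ t :* q)) :+ (p :- q) :* (con 1ℚ :- t) := z :- q)
        refl (seq z n) (seq t n) p q)
      (null-+ z≈ (null-* (p ℚ.- q) 1-t→0))

-- On the supporting line the functional is constant, so at a common point of
-- the two segments it is the convex combination of its values at u and v.
meet-null : ∀ a b u v u′ v′ Z → linear (a , b) u′ ≡ linear (a , b) v′ →
  ((t , _) : OnSegment (point u) (point v) Z) → OnSegment (point u′) (point v′) Z →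
  Null (λ n → (linear (a , b) u′ ℚ.- linear (a , b) u) ℚ.* (1ℚ ℚ.- seq t n) ℚ.+
              (linear (a , b) u′ ℚ.- linear (a , b) v) ℚ.* seq t n)
meet-null a b (u₁ , u₂) (v₁ , v₂) (p₁ , p₂) (q₁ , q₂) Z level
  (t , _ , _ , x≈ , y≈) (s , _ , _ , x≈′ , y≈′) =
  null-cong (λ n → eq (seq (xcoord Z) n) (seq (ycoord Z) n) (seq t n) (seq s n))
    (null-+ (null-* a (null-+ x≈ (null-* (ℚ.- 1ℚ) x≈′)))
            (null-* b (null-+ y≈ (null-* (ℚ.- 1ℚ) y≈′))))
  where
    combine-eq : ∀ z₁ z₂ p₁ p₂ q₁ q₂ →
      a ℚ.* ((z₁ ℚ.- p₁) ℚ.+ (ℚ.- 1ℚ) ℚ.* (z₁ ℚ.- q₁)) ℚ.+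
      b ℚ.* ((z₂ ℚ.- p₂) ℚ.+ (ℚ.- 1ℚ) ℚ.* (z₂ ℚ.- q₂)) ≡
      linear (a , b) (q₁ , q₂) ℚ.- linear (a , b) (p₁ , p₂)
    combine-eq = solve 8 (λ a b z₁ z₂ p₁ p₂ q₁ q₂ →
      a :* ((z₁ :- p₁) :+ (:- con 1ℚ) :* (z₁ :- q₁)) :+
      b :* ((z₂ :- p₂) :+ (:- con 1ℚ) :* (z₂ :- q₂)) :=
      (a :* q₁ :+ b :* q₂) :- (a :* p₁ :+ b :* p₂)) refl a b
    convex-eq : ∀ u₁ u₂ v₁ v₂ t →
      linear (a , b) ((1ℚ ℚ.- t) ℚ.* u₁ ℚ.+ t ℚ.* v₁ , (1ℚ ℚ.- t) ℚ.* u₂ ℚ.+ t ℚ.* v₂) ≡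
      (1ℚ ℚ.- t) ℚ.* linear (a , b) (u₁ , u₂) ℚ.+ t ℚ.* linear (a , b) (v₁ , v₂)
    convex-eq = solve 7 (λ a b u₁ u₂ v₁ v₂ t →
      a :* ((con 1ℚ :- t) :* u₁ :+ t :* v₁) :+ b :* ((con 1ℚ :- t) :* u₂ :+ t :* v₂) :=
      (con 1ℚ :- t) :* (a :* u₁ :+ b :* u₂) :+ t :* (a :* v₁ :+ b :* v₂)) refl a b
    gap-eq : ∀ c d e t s →
      ((1ℚ ℚ.- s) ℚ.* c ℚ.+ s ℚ.* c) ℚ.- ((1ℚ ℚ.- t) ℚ.* d ℚ.+ t ℚ.* e) ≡
      (c ℚ.- d) ℚ.* (1ℚ ℚ.- t) ℚ.+ (c ℚ.- e) ℚ.* t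
    gap-eq = solve 5 (λ c d e t s →
      ((con 1ℚ :- s) :* c :+ s :* c) :- ((con 1ℚ :- t) :* d :+ t :* e) :=
      (c :- d) :* (con 1ℚ :- t) :+ (c :- e) :* t) refl
    fu = linear (a , b) (u₁ , u₂)
    fv = linear (a , b) (v₁ , v₂)
    fp = linear (a , b) (p₁ , p₂)
    eq : ∀ z₁ z₂ t s →
      a ℚ.* ((z₁ ℚ.- ((1ℚ ℚ.- t) ℚ.* u₁ ℚ.+ t ℚ.* v₁)) ℚ.+
        (ℚ.- 1ℚ) ℚ.* (z₁ ℚ.- ((1ℚ ℚ.- s) ℚ.* p₁ ℚ.+ s ℚ.* q₁))) ℚ.+
      b ℚ.* ((z₂ ℚ.- ((1ℚ ℚ.- t) ℚ.* u₂ ℚ.+ t ℚ.* v₂)) ℚ.+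
        (ℚ.- 1ℚ) ℚ.* (z₂ ℚ.- ((1ℚ ℚ.- s) ℚ.* p₂ ℚ.+ s ℚ.* q₂))) ≡
      (fp ℚ.- fu) ℚ.* (1ℚ ℚ.- t) ℚ.+ (fp ℚ.- fv) ℚ.* t
    eq z₁ z₂ t s = trans
      (combine-eq z₁ z₂ ((1ℚ ℚ.- t) ℚ.* u₁ ℚ.+ t ℚ.* v₁) ((1ℚ ℚ.- t) ℚ.* u₂ ℚ.+ t ℚ.* v₂)
        ((1ℚ ℚ.- s) ℚ.* p₁ ℚ.+ s ℚ.* q₁) ((1ℚ ℚ.- s) ℚ.* p₂ ℚ.+ s ℚ.* q₂))
      (trans (cong₂ ℚ._-_
          (trans (convex-eq p₁ p₂ q₁ q₂ s) (cong (λ d → (1ℚ ℚ.- s) ℚ.* fp ℚ.+ s ℚ.* d) (sym level)))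
          (convex-eq u₁ u₂ v₁ v₂ t))
        (gap-eq fp fu fv t s))

1-t-nonNeg : ∀ t → t ≤ 1ℝ → NonNegLimit (λ n → 1ℚ ℚ.- seq t n)
1-t-nonNeg t t≤1 ε 0<ε with t≤1 ε 0<ε
... | N , h = N , λ n n≥ → subst (0ℚ ℚ.≤_)
  (solve 2 (λ t ε → (con 1ℚ :+ ε) :- t := (con 1ℚ :- t) :+ ε) refl (seq t n) ε) (gap-≤ (h n n≥))

module _ (f u v u′ v′ : ℚ²) (level : linear f u′ ≡ linear f v′)
         (u≤ : linear f u ℚ.≤ linear f u′) (v≤ : linear f v ℚ.≤ linear f u′) (Z : Point) where

  private
    1-t-null : linear f u ℚ.< linear f u′ → ((t , _) : OnSegment (point u) (point v) Z) →
      OnSegment (point u′) (point v′) Z → Null (λ n → 1ℚ ℚ.- seq t n)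
    1-t-null u< on@(t , 0≤t , t≤1 , _) on′ =
      null-summand (gap-< u<) (gap-≤ v≤) (1-t-nonNeg t t≤1) 0≤t
        (meet-null (proj₁ f) (proj₂ f) u v u′ v′ Z level on on′)

    t-null : linear f v ℚ.< linear f u′ → ((t , _) : OnSegment (point u) (point v) Z) →
      OnSegment (point u′) (point v′) Z → Null (seq t)
    t-null v< on@(t , 0≤t , t≤1 , _) on′ =
      null-summand (gap-< v<) (gap-≤ u≤) 0≤t (1-t-nonNeg t t≤1)
        (null-cong (λ n → ℚ.+-comm ((linear f u′ ℚ.- linear f u) ℚ.* (1ℚ ℚ.- seq t n))
                                   ((linear f u′ ℚ.- linear f v) ℚ.* seq t n))
          (meet-null (proj₁ f) (proj₂ f) u v u′ v′ Z level on on′))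

  -- The weight t of `v` has the positive coefficient f(u′) - f(v), so it tends to 0 and the common
  -- point is `u`.
  meet-at-start : linear f v ℚ.< linear f u′ →
    OnSegment (point u) (point v) Z → OnSegment (point u′) (point v′) Z → Z ≈ₚ point u
  meet-at-start v< on@(t , _ , _ , Z≈) on′ = near-start u v Z t (t-null v< on on′) Z≈

  meet-at-end : linear f u ℚ.< linear f u′ →
    OnSegment (point u) (point v) Z → OnSegment (point u′) (point v′) Z → Z ≈ₚ point v
  meet-at-end u< on@(t , _ , _ , Z≈) on′ = near-end u v Z t (1-t-null u< on on′) Z≈

  -- Both weights would tend to 0, yet they always add up to 1.
  never-meet : linear f u ℚ.< linear f u′ → linear f v ℚ.< linear f u′ →
    OnSegment (point u) (point v) Z → OnSegment (point u′) (point v′) Z → ⊥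
  never-meet u< v< on@(t , _) on′ = ℚ.1≢0 (null-const (null-cong
      (λ n → solve 1 (λ t → (con 1ℚ :- t) :+ t := con 1ℚ) refl (seq t n))
      (null-+ {λ n → 1ℚ ℚ.- seq t n} {seq t} (1-t-null u< on on′) (t-null v< on on′))))

-- Only the closing edge r has next r before r, hence the condition q ≢ next r.
Supported : ∀ {n} → (Fin n → ℚ²) → Set
Supported V = ∀ r → ∃[ f ] linear f (V r) ≡ linear f (V (next r)) ×
  (∀ q → q Fin.< r → q ≢ next r → linear f (V q) ℚ.< linear f (V r))

-- The successor of `r` is either `zero` or `r` + 1, and `p` + 1 with `p` before `r` is neither.
-- This supplies the exclusion condition of `Supported` at the far end of an earlier edge.
suc≢next : ∀ {n} (p : Fin n) r → inject₁ p Fin.< r → suc p ≢ next r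
suc≢next p r p<r eq with view r
... | ‵fromℕ {n} = contradiction (trans eq (next-fromℕ n)) λ ()
... | ‵inj₁ {i = r′} _ = ℕ.<-irrefl (cong toℕ (cong inject₁ (Fin.suc-injective (trans eq (next-inject₁ r′))))) p<r

module _ {n : ℕ} (X : Instance n) (V : Fin n → ℚ²) (pt≡ : ∀ i → pt X i ≡ point (V i)) where

  private
    T = Perm.id {n}

    onEdge : ∀ {p q} Z → q ≡ next p → OnEdge X T p Z → OnSegment (point (V p)) (point (V q)) Z
    onEdge {p} Z refl = subst₂ (λ P Q → OnSegment P Q Z) (pt≡ p) (pt≡ (next p))

    at : ∀ Z i → Z ≈ₚ point (V i) → Z ≈ₚ pt X i
    at Z i = subst (Z ≈ₚ_) (sym (pt≡ i))

    -- The functional of the later edge `r` is strictly smaller at the ends of edge `p` that are not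
    -- shared with `r`. Which ends are shared decides where the two edges can meet.
    ordered : Supported V → ∀ p r → p Fin.< r → ¬ SameEdge X T p r → ∀ Z →
      OnEdge X T p Z → OnEdge X T r Z →
      ∃[ k ] Endpoint X T p k × Endpoint X T r k × Z ≈ₚ pt X k
    ordered sup p r p<r different Z on on′ with view p | sup r
    ... | ‵fromℕ | _ = contradiction (Fin.≤fromℕ r) (ℕ.<⇒≱ p<r)
    ... | ‵inj₁ {i = p′} _ | f , level , below = split (p Fin.≟ next r) (suc p′ Fin.≟ r)
      where
        next-p = sym (next-inject₁ p′)
        segment = onEdge Z next-p on
        segment′ = onEdge {r} Z refl on′
        p<r′ : suc p′ Fin.≤ r
        p<r′ = subst (λ k → suc k ℕ.≤ toℕ r) (Fin.toℕ-inject₁ p′) p<r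
        split : _ → _ → _
        -- Sharing both ends happens only for n = 2, where the two edges are the same unordered
        -- pair.
        split (yes p≡) (yes s≡) = contradiction (inj₂ (p≡ , trans (sym next-p) s≡)) different
        -- Here `r` is the closing edge and `p` is the first one.
        split (yes p≡) (no s≢) = p , inj₁ refl , inj₂ p≡ , at Z p
          (meet-at-start f (V p) (V (suc p′)) (V r) (V (next r)) level
            (ℚ.≤-reflexive (trans (cong (linear f ∘ V) p≡) (sym level))) (ℚ.<⇒≤ s<) Z s< segment segment′)
          where s< = below (suc p′) (Fin.≤∧≢⇒< p<r′ s≢) (suc≢next p′ r p<r)
        split (no p≢) (yes s≡) = suc p′ , inj₂ next-p , inj₁ s≡ , at Z (suc p′)
          (meet-at-end f (V p) (V (suc p′)) (V r) (V (next r)) level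
            (ℚ.<⇒≤ p<) (ℚ.≤-reflexive (cong (linear f ∘ V) s≡)) Z p< segment segment′)
          where p< = below p p<r p≢
        split (no p≢) (no s≢) = ⊥-elim
          (never-meet f (V p) (V (suc p′)) (V r) (V (next r)) level
            (ℚ.<⇒≤ p<) (ℚ.<⇒≤ s<) Z p< s< segment segment′)
          where
            p< = below p p<r p≢
            s< = below (suc p′) (Fin.≤∧≢⇒< p<r′ s≢) (suc≢next p′ r p<r)

  supported⇒noncrossing : Supported V → Noncrossing X T
  supported⇒noncrossing sup i j different Z on on′ with Fin.<-cmp i j
  ... | tri< i<j _ _ = ordered sup i j i<j different Z on on′
  ... | tri≈ _ refl _ = contradiction (inj₁ (refl , refl)) different
  ... | tri> _ _ j<i with ordered sup j i j<i (different ∘ reverse) Z on′ on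
    where
      reverse : SameEdge X T j i → SameEdge X T i j
      reverse (inj₁ (a , b)) = inj₁ (sym a , sym b)
      reverse (inj₂ (a , b)) = inj₂ (sym b , sym a)
  ... | k , e , e′ , Z≈ = k , e′ , e , Z≈

-- Index pairs in the order of the alternating tour

pattern left  = zero
pattern right = suc zero

-- `combine` numbers the pair (i , `left`) by 2i and (i , `right`) by 2i + 1, which is the order L₀
-- R₀ L₁ R₁ ....
next-left : ∀ {k} (i : Fin k) → next (combine {n = 2} i left) ≡ combine i right
next-left i = next-suc (trans (Fin.toℕ-combine {n = 2} i right)
  (trans (ℕ.+-suc (2 ℕ.* toℕ i) 0) (cong suc (sym (Fin.toℕ-combine {n = 2} i left)))))

next-right : ∀ {k} (i : Fin (suc k)) → next (combine {n = 2} i right) ≡ combine (next i) left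
next-right i with view i
... | ‵fromℕ {n} = trans (next-last (begin
    toℕ (combine {n = 2} (fromℕ n) right)             ≡⟨ Fin.toℕ-combine {n = 2} (fromℕ n) right ⟩
    2 ℕ.* toℕ (fromℕ n) ℕ.+ 1                         ≡⟨ cong (λ m → 2 ℕ.* m ℕ.+ 1) (Fin.toℕ-fromℕ n) ⟩
    2 ℕ.* n ℕ.+ 1                                     ≡⟨ ℕ.+-comm (2 ℕ.* n) 1 ⟩
    suc (2 ℕ.* n)                                     ≡⟨ cong suc (ℕ.*-comm 2 n) ⟩
    suc (n ℕ.* 2)                                     ∎))
  (cong (λ j → combine j left) (sym (next-fromℕ n)))
  where open ≡-Reasoning
... | ‵inj₁ {i = j} _ = trans (next-suc (begin
    toℕ (combine {n = 2} (suc j) left)                ≡⟨ Fin.toℕ-combine {n = 2} (suc j) left ⟩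
    2 ℕ.* suc (toℕ j) ℕ.+ 0                           ≡⟨ ℕ.+-identityʳ _ ⟩
    2 ℕ.* suc (toℕ j)                                 ≡⟨ ℕ.*-suc 2 (toℕ j) ⟩
    suc (suc (2 ℕ.* toℕ j))                           ≡⟨ cong suc (ℕ.+-comm 1 (2 ℕ.* toℕ j)) ⟩
    suc (2 ℕ.* toℕ j ℕ.+ 1)                           ≡⟨ cong (λ m → suc (2 ℕ.* m ℕ.+ 1)) (Fin.toℕ-inject₁ j) ⟨
    suc (2 ℕ.* toℕ (inject₁ j) ℕ.+ 1)                 ≡⟨ cong suc (Fin.toℕ-combine {n = 2} (inject₁ j) right) ⟨
    suc (toℕ (combine {n = 2} (inject₁ j) right))     ∎))
  (cong (λ j → combine j left) (sym (next-inject₁ j)))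
  where open ≡-Reasoning

combine-<⇒ : ∀ {m n} {i i′ : Fin m} {j j′ : Fin n} → combine i j Fin.< combine i′ j′ →
  i Fin.< i′ ⊎ (i ≡ i′ × j Fin.< j′)
combine-<⇒ {n = n} {i} {i′} {j} {j′} lt with Fin.<-cmp i i′
... | tri< i<i′ _ _ = inj₁ i<i′
... | tri> _ _ i′<i = contradiction (Fin.combine-monoˡ-< j′ j i′<i) (ℕ.<⇒≯ lt)
... | tri≈ _ refl _ = inj₂ (refl , ℕ.+-cancelˡ-< (n ℕ.* toℕ i) _ _
  (subst₂ ℕ._<_ (Fin.toℕ-combine i j) (Fin.toℕ-combine i j′) lt))

quotient-mono : ∀ {m} n {p q : Fin (m ℕ.* n)} → p Fin.≤ q →
  proj₁ (remQuot {m} n p) Fin.≤ proj₁ (remQuot {m} n q)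
quotient-mono {m} n {p} {q} p≤q = ℕ.≮⇒≥ λ q<p → ℕ.<⇒≱
  (subst₂ Fin._<_ (Fin.combine-remQuot {m} n q) (Fin.combine-remQuot {m} n p)
    (Fin.combine-monoˡ-< (proj₂ (remQuot {m} n q)) (proj₂ (remQuot {m} n p)) q<p)) p≤q

-- Tour lengths for points near two cluster centres

-- The abscissa of the centre, (0 , 0) or (1 , 0), around which that half of the points clusters.
side : Fin 2 → ℚ
side left  = 0ℚ
side right = 1ℚ

side-mono : ∀ {i j} → i Fin.≤ j → side i ℚ.≤ side j
side-mono {left}  {left}  _ = ℚ.≤-refl
side-mono {left}  {right} _ = ℚ.<⇒≤ 0<1
side-mono {right} {right} _ = ℚ.≤-refl

side-gap : ∀ i j → ℚ.∣ side i ℚ.- side j ∣ ℚ.≤ 1ℚ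
side-gap left  left  = ℚ.<⇒≤ 0<1
side-gap left  right = ℚ.≤-refl
side-gap right left  = ℚ.≤-refl
side-gap right right = ℚ.<⇒≤ 0<1

-- Each point is moved to its centre, (`s` , 0) or (`s′` , 0), at a taxicab cost of at most `η`.
near⇒∣-∣≤ : ∀ a b s a′ b′ s′ {η} →
  ℚ.∣ a ℚ.- s ∣ ℚ.+ ℚ.∣ b ∣ ℚ.≤ η → ℚ.∣ a′ ℚ.- s′ ∣ ℚ.+ ℚ.∣ b′ ∣ ℚ.≤ η →
  ℚ.∣ a ℚ.- a′ ∣ ℚ.+ ℚ.∣ b ℚ.- b′ ∣ ℚ.≤ ℚ.∣ s ℚ.- s′ ∣ ℚ.+ (η ℚ.+ η)
near⇒∣-∣≤ a b s a′ b′ s′ {η} near near′ = begin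
  ℚ.∣ a ℚ.- a′ ∣ ℚ.+ ℚ.∣ b ℚ.- b′ ∣
    ≤⟨ ℚ.+-mono-≤ (ℚ.≤-trans (∣-∣-triangle a s a′)
         (ℚ.+-monoʳ-≤ ℚ.∣ a ℚ.- s ∣ (∣-∣-triangle s s′ a′))) (ℚ.∣p-q∣≤∣p∣+∣q∣ b b′) ⟩
  (ℚ.∣ a ℚ.- s ∣ ℚ.+ (d ℚ.+ ℚ.∣ s′ ℚ.- a′ ∣)) ℚ.+ (ℚ.∣ b ∣ ℚ.+ ℚ.∣ b′ ∣)
    ≡⟨ cong (λ e → (ℚ.∣ a ℚ.- s ∣ ℚ.+ (d ℚ.+ e)) ℚ.+ (ℚ.∣ b ∣ ℚ.+ ℚ.∣ b′ ∣)) (∣p-q∣≡∣q-p∣ s′ a′) ⟩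
  (ℚ.∣ a ℚ.- s ∣ ℚ.+ (d ℚ.+ ℚ.∣ a′ ℚ.- s′ ∣)) ℚ.+ (ℚ.∣ b ∣ ℚ.+ ℚ.∣ b′ ∣)
    ≡⟨ solve 5 (λ p d q r t → (p :+ (d :+ q)) :+ (r :+ t) := d :+ ((p :+ r) :+ (q :+ t)))
         refl ℚ.∣ a ℚ.- s ∣ d ℚ.∣ a′ ℚ.- s′ ∣ ℚ.∣ b ∣ ℚ.∣ b′ ∣ ⟩
  d ℚ.+ ((ℚ.∣ a ℚ.- s ∣ ℚ.+ ℚ.∣ b ∣) ℚ.+ (ℚ.∣ a′ ℚ.- s′ ∣ ℚ.+ ℚ.∣ b′ ∣))
    ≤⟨ ℚ.+-monoʳ-≤ d (ℚ.+-mono-≤ near near′) ⟩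
  d ℚ.+ (η ℚ.+ η) ∎
  where
    open ℚ.≤-Reasoning
    d = ℚ.∣ s ℚ.- s′ ∣

sum-shift : ∀ n (f : Fin n → ℚ) e → sum (λ i → f i ℚ.+ e) ≡ sum f ℚ.+ ι n ℚ.* e
sum-shift n f e = trans (∑-distrib-+ f (λ _ → e)) (cong (sum f ℚ.+_) (sum-const n e))

sum-ones : ∀ n → sum {n} (λ _ → 1ℚ) ≡ ι n
sum-ones n = trans (sum-const n 1ℚ) (ℚ.*-identityʳ (ι n))

ℓ-≤ : ∀ {n} (X : Instance n) T m (f : Fin n → ℚ) {e} →
  (∀ i → seq (dist (pt X (tail T i)) (pt X (head T i))) m ℚ.≤ f i ℚ.+ e) →
  seq (ℓ X T) m ℚ.≤ sum f ℚ.+ ι n ℚ.* e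
ℓ-≤ {n} X T m f {e} h = ℚ.≤-trans
  (Σ-upper {f = λ i → dist (pt X (tail T i)) (pt X (head T i))} m h)
  (ℚ.≤-reflexive (sum-shift n f e))

ℓ-≥ : ∀ {n} (X : Instance n) T (f : Fin n → ℚ) →
  (∀ i → fromℚ (f i) ≤ dist (pt X (tail T i)) (pt X (head T i))) →
  fromℚ (sum f) ≤ ℓ X T
ℓ-≥ X T f = Σ-lower {g = f} {f = λ i → dist (pt X (tail T i)) (pt X (head T i))}

dist-nonNeg : ∀ P Q m → 0ℚ ℚ.≤ seq (dist P Q) m
dist-nonNeg P Q m = 0≤lower _ m

ℓ-nonNeg : ∀ {n} (X : Instance n) T m → 0ℚ ℚ.≤ seq (ℓ X T) m
ℓ-nonNeg X T m = Σ-nonNeg {f = λ i → dist (pt X (tail T i)) (pt X (head T i))} m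
  λ i → dist-nonNeg (pt X (tail T i)) (pt X (head T i)) m

-- `η` is the excess of a whole tour, not the displacement of one point. Upper bounds are required
-- at every index, since the square roots are approximated from below; lower bounds hold only in the
-- limit.
Wide : ℕ → ℚ → Set
Wide n η = ∃[ X ] ∃[ long ] ∃[ short ] Noncrossing X long
  × (∀ T → fromℚ (1ℚ ℚ.+ 1ℚ) ≤ ℓ {n} X T)
  × (∀ T m → seq (ℓ X T) m ℚ.≤ ι n ℚ.+ η)
  × fromℚ (ι n) ≤ ℓ X long
  × (∀ m → seq (ℓ X short) m ℚ.≤ (1ℚ ℚ.+ 1ℚ) ℚ.+ η)

module _ {n : ℕ} (V : Fin n → ℚ²) (σ : Fin n → ℚ) {e : ℚ} (p₀ : Fin n) (bundled : Tour n)
         (V-injective : ∀ {p q} → V p ≡ V q → p ≡ q) (supported : Supported V)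
         (σ-gap : ∀ p q → ℚ.∣ σ p ℚ.- σ q ∣ ℚ.≤ 1ℚ)
         (near : ∀ p → ℚ.∣ proj₁ (V p) ℚ.- σ p ∣ ℚ.+ ℚ.∣ proj₂ (V p) ∣ ℚ.≤ e)
         (1≤edge : ∀ p → 1ℚ ℚ.≤ ℚ.∣ proj₁ (V p) ℚ.- proj₁ (V (next p)) ∣)
         (bundled-variation : variation (σ ∘ (bundled ⟨$⟩ʳ_)) ℚ.≤ 1ℚ ℚ.+ 1ℚ) where

  private
    X : Instance n
    X = record { pt = point ∘ V ; distinct = V-injective ∘ point-injective }

    dist-≤ : ∀ p q m → seq (dist (pt X p) (pt X q)) m ℚ.≤ ℚ.∣ σ p ℚ.- σ q ∣ ℚ.+ (e ℚ.+ e)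
    dist-≤ p q m = dist-upper (V p) (V q) m (near⇒∣-∣≤ (proj₁ (V p)) (proj₂ (V p)) (σ p)
      (proj₁ (V q)) (proj₂ (V q)) (σ q) (near p) (near q))

    -- `p₀` and `next p₀` are at least 1 apart horizontally, and `T` has to travel between them in
    -- both directions. The inverse of `T` gives their positions in that tour.
    2≤ℓ : ∀ T → fromℚ (1ℚ ℚ.+ 1ℚ) ≤ ℓ X T
    2≤ℓ T = fromℚ-≤-trans {x = ℓ X T}
      (ℚ.≤-trans (ℚ.+-mono-≤ 1≤gap 1≤gap) (variation-lower f (T ⟨$⟩ˡ p₀) (T ⟨$⟩ˡ next p₀)))
      (ℓ-≥ X T (λ i → ℚ.∣ f i ℚ.- f (next i) ∣) λ i → dist-lower (V (tail T i)) (V (head T i)))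
      where
        f : Fin n → ℚ
        f p = proj₁ (V (T ⟨$⟩ʳ p))
        1≤gap : 1ℚ ℚ.≤ ℚ.∣ f (T ⟨$⟩ˡ p₀) ℚ.- f (T ⟨$⟩ˡ next p₀) ∣
        1≤gap = subst₂ (λ p q → 1ℚ ℚ.≤ ℚ.∣ proj₁ (V p) ℚ.- proj₁ (V q) ∣)
          (sym (Perm.inverseʳ T)) (sym (Perm.inverseʳ T)) (1≤edge p₀)

  -- Each of the `n` edges contributes an error of at most `e` at each of its two ends.
  spread⇒wide : Wide n (ι n ℚ.* (e ℚ.+ e))
  spread⇒wide = X , Perm.id , bundled , supported⇒noncrossing X V (λ _ → refl) supported , 2≤ℓ
    , (λ T m → subst (λ z → seq (ℓ X T) m ℚ.≤ z ℚ.+ ι n ℚ.* (e ℚ.+ e)) (sum-ones n)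
        (ℓ-≤ X T m (λ _ → 1ℚ) λ i → ℚ.≤-trans (dist-≤ (tail T i) (head T i) m)
          (ℚ.+-monoˡ-≤ (e ℚ.+ e) (σ-gap (tail T i) (head T i)))))
    , fromℚ-≤-trans {x = ℓ X Perm.id}
        (ℚ.≤-trans (ℚ.≤-reflexive (sym (sum-ones n))) (sum-mono 1≤edge))
        (ℓ-≥ X Perm.id (λ i → ℚ.∣ proj₁ (V i) ℚ.- proj₁ (V (next i)) ∣)
          λ i → dist-lower (V i) (V (next i)))
    , λ m → ℚ.≤-trans
        (ℓ-≤ X bundled m (λ i → ℚ.∣ σ (tail bundled i) ℚ.- σ (head bundled i) ∣)
          λ i → dist-≤ (tail bundled i) (head bundled i) m)
        (ℚ.+-monoˡ-≤ (ι n ℚ.* (e ℚ.+ e)) bundled-variation)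

-- The tour L₀ R₀ L₁ R₁ … with Lᵢ = (0 , y i) and Rᵢ = (x i , 0).  Its edges
-- above the x-axis form a zigzag moving away from the origin, and the edges
-- at L₀ lie below the x-axis.
module Zigzag (k : ℕ) (x y : ℕ → ℚ)
  (x-mono : ∀ {i j} → i ℕ.< j → x i ℚ.< x j) (y-mono : ∀ {i j} → i ℕ.< j → y i ℚ.< y j)
  (1≤x₀ : 1ℚ ℚ.≤ x 0) (y₀<0 : y 0 ℚ.< 0ℚ) (0<y₁ : 0ℚ ℚ.< y 1) where

  n : ℕ
  n = suc k ℕ.* 2

  vertex : Fin (suc k) × Fin 2 → ℚ²
  vertex (i , left)  = 0ℚ , y (toℕ i)
  vertex (i , right) = x (toℕ i) , 0ℚ

  index : Fin n → Fin (suc k) × Fin 2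
  index = remQuot {suc k} 2

  V : Fin n → ℚ²
  V = vertex ∘ index

  mono⇒injective : ∀ {f : ℕ → ℚ} → (∀ {i j} → i ℕ.< j → f i ℚ.< f j) → ∀ {i j} → f i ≡ f j → i ≡ j
  mono⇒injective mono {i} {j} eq with ℕ.<-cmp i j
  ... | tri< i<j _ _ = contradiction (mono i<j) (ℚ.<-irrefl eq)
  ... | tri≈ _ i≡j _ = i≡j
  ... | tri> _ _ j<i = contradiction (mono j<i) (ℚ.<-irrefl (sym eq))

  1≤x : ∀ i → 1ℚ ℚ.≤ x i
  1≤x zero    = 1≤x₀
  1≤x (suc i) = ℚ.≤-trans 1≤x₀ (ℚ.<⇒≤ (x-mono ℕ.z<s))

  0<x : ∀ i → 0ℚ ℚ.< x i
  0<x i = ℚ.<-≤-trans 0<1 (1≤x i)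

  0<y : ∀ i → 0 ℕ.< i → 0ℚ ℚ.< y i
  0<y (suc zero)    _ = 0<y₁
  0<y (suc (suc i)) _ = ℚ.<-trans 0<y₁ (y-mono (ℕ.s<s ℕ.z<s))

  vertex-injective : ∀ u v → vertex u ≡ vertex v → u ≡ v
  vertex-injective (i , left) (j , left) eq =
    cong (_, left) (Fin.toℕ-injective (mono⇒injective y-mono (cong proj₂ eq)))
  vertex-injective (i , left) (j , right) eq = contradiction (0<x (toℕ j)) (ℚ.<-irrefl (cong proj₁ eq))
  vertex-injective (i , right) (j , left) eq = contradiction (0<x (toℕ i)) (ℚ.<-irrefl (sym (cong proj₁ eq)))
  vertex-injective (i , right) (j , right) eq =
    cong (_, right) (Fin.toℕ-injective (mono⇒injective x-mono (cong proj₁ eq)))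

  V-injective : ∀ {p q} → V p ≡ V q → p ≡ q
  V-injective {p} {q} eq = trans (sym (Fin.combine-remQuot {suc k} 2 p))
    (trans (cong (uncurry combine) (vertex-injective (index p) (index q) eq))
      (Fin.combine-remQuot {suc k} 2 q))

  on-left : ∀ a b i → linear (a , b) (vertex (i , left)) ≡ b ℚ.* y (toℕ i)
  on-left a b i = trans (cong (ℚ._+ b ℚ.* y (toℕ i)) (ℚ.*-zeroʳ a)) (ℚ.+-identityˡ _)

  on-right : ∀ a b i → linear (a , b) (vertex (i , right)) ≡ a ℚ.* x (toℕ i)
  on-right a b i = trans (cong (a ℚ.* x (toℕ i) ℚ.+_) (ℚ.*-zeroʳ b)) (ℚ.+-identityʳ _)

  succ : Fin (suc k) × Fin 2 → Fin (suc k) × Fin 2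
  succ (i , left)  = i , right
  succ (i , right) = next i , left

  next-combine : ∀ u → next (uncurry combine u) ≡ uncurry combine (succ u)
  next-combine (i , left)  = next-left i
  next-combine (i , right) = next-right i

  left-< : ∀ a b {c} i u → linear (a , b) (vertex u) ≡ c → b ℚ.* y (toℕ i) ℚ.< c →
    linear (a , b) (vertex (i , left)) ℚ.< linear (a , b) (vertex u)
  left-< a b i u eq = subst₂ ℚ._<_ (sym (on-left a b i)) (sym eq)

  right-< : ∀ a b {c} i u → linear (a , b) (vertex u) ≡ c → a ℚ.* x (toℕ i) ℚ.< c →
    linear (a , b) (vertex (i , right)) ℚ.< linear (a , b) (vertex u)
  right-< a b i u eq = subst₂ ℚ._<_ (sym (on-right a b i)) (sym eq)

  SupportedAt : Fin (suc k) × Fin 2 → Set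
  SupportedAt u = ∃[ f ] linear f (vertex u) ≡ linear f (vertex (succ u)) ×
    (∀ v → uncurry combine v Fin.< uncurry combine u → v ≢ succ u →
      linear f (vertex v) ℚ.< linear f (vertex u))

  -- The line through (0 , a) and (b , 0) is bX + aY = ab with the roles of X and Y exchanged: for a
  -- = `y i` and b = `x i` the functional aX + bY takes the value ab at both points.
  supported-left : ∀ i → SupportedAt (i , left)
  supported-left i = (a , b) , trans (on-left a b i) (trans ba≡ab (sym (on-right a b i))) , below
    where
      a = y (toℕ i)
      b = x (toℕ i)
      ba≡ab = ℚ.*-comm b a
      below : ∀ v → uncurry combine v Fin.< combine i left → v ≢ (i , right) →
        linear (a , b) (vertex v) ℚ.< linear (a , b) (vertex (i , left))
      below (j , left) lt _ with combine-<⇒ {i = j} {i} {left} {left} lt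
      ... | inj₁ j<i = left-< a b j (i , left) (on-left a b i)
        (ℚ.*-monoʳ-<-pos b {{ℚ.positive (0<x (toℕ i))}} (y-mono j<i))
      -- An earlier right point forces i > 0 and hence a > 0; nothing precedes L₀, the only left
      -- point with a < 0.
      below (j , right) lt _ with combine-<⇒ {i = j} {i} {right} {left} lt
      ... | inj₁ j<i = right-< a b j (i , left) (trans (on-left a b i) ba≡ab)
        (ℚ.*-monoʳ-<-pos a {{ℚ.positive (0<y (toℕ i) (ℕ.≤-<-trans ℕ.z≤n j<i))}} (x-mono j<i))

  supported-right : ∀ i → SupportedAt (i , right)
  supported-right i with view i
  ... | ‵inj₁ {i = i′} _ = (a , b) , level , below
    where
      a = y (suc (toℕ i′))
      b = x (toℕ (inject₁ i′))
      level : linear (a , b) (vertex (inject₁ i′ , right)) ≡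
              linear (a , b) (vertex (next (inject₁ i′) , left))
      level = trans (on-right a b (inject₁ i′)) (trans (ℚ.*-comm a b)
        (trans (sym (on-left a b (suc i′)))
          (cong (λ j → linear (a , b) (vertex (j , left))) (sym (next-inject₁ i′)))))
      0<a : 0ℚ ℚ.< a
      0<a = 0<y (suc (toℕ i′)) ℕ.z<s
      0<b : 0ℚ ℚ.< b
      0<b = 0<x (toℕ (inject₁ i′))
      ≤i : ∀ j → combine j left Fin.< combine (inject₁ i′) right → toℕ j ℕ.< suc (toℕ i′)
      ≤i j lt with combine-<⇒ {i = j} {inject₁ i′} {left} {right} lt
      ... | inj₁ j<i        = ℕ.m<n⇒m<1+n (subst (toℕ j ℕ.<_) (Fin.toℕ-inject₁ i′) j<i)
      ... | inj₂ (refl , _) = ℕ.s≤s (ℕ.≤-reflexive (Fin.toℕ-inject₁ i′))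
      below : ∀ v → uncurry combine v Fin.< combine (inject₁ i′) right → v ≢ succ (inject₁ i′ , right) →
        linear (a , b) (vertex v) ℚ.< linear (a , b) (vertex (inject₁ i′ , right))
      below (j , left) lt _ = left-< a b j (inject₁ i′ , right)
        (trans (on-right a b (inject₁ i′)) (ℚ.*-comm a b))
        (ℚ.*-monoʳ-<-pos b {{ℚ.positive 0<b}} (y-mono (≤i j lt)))
      below (j , right) lt _ with combine-<⇒ {i = j} {inject₁ i′} {right} {right} lt
      ... | inj₁ j<i = right-< a b j (inject₁ i′ , right) (on-right a b (inject₁ i′))
        (ℚ.*-monoʳ-<-pos a {{ℚ.positive 0<a}} (x-mono j<i))
      ... | inj₂ (_ , ℕ.s≤s ())
  ... | ‵fromℕ = (a , b) , level , below
    where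
      -- Since `y 0` is negative, the functional (`y 0` , r) would be larger at the other vertices
      -- than on the closing edge; reversing both signs puts them below.
      a = ℚ.- y 0
      r = x (toℕ (fromℕ k))
      b = ℚ.- r
      level : linear (a , b) (vertex (fromℕ k , right)) ≡
              linear (a , b) (vertex (next (fromℕ k) , left))
      level = trans (on-right a b (fromℕ k)) (trans
        (solve 2 (λ y r → (:- y) :* r := (:- r) :* y) refl (y 0) r)
        (trans (sym (on-left a b zero))
          (cong (λ j → linear (a , b) (vertex (j , left))) (sym (next-fromℕ k)))))
      0<a : 0ℚ ℚ.< a
      0<a = ℚ.neg-antimono-< y₀<0
      below : ∀ v → uncurry combine v Fin.< combine (fromℕ k) right → v ≢ succ (fromℕ k , right) →
        linear (a , b) (vertex v) ℚ.< linear (a , b) (vertex (fromℕ k , right))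
      -- L₀ is the far end of the closing edge, where equality holds.
      below (zero , left) lt ≢next = contradiction (cong (_, left) (sym (next-fromℕ k))) ≢next
      below (suc j , left) lt _ = left-< a b (suc j) (fromℕ k , right) (on-right a b (fromℕ k))
        (<-by-gap (r ℚ.* y (suc (toℕ j)) ℚ.+ a ℚ.* r)
          (nonNeg+pos (ℚ.<⇒≤ (pos* (0<x (toℕ (fromℕ k))) (0<y (suc (toℕ j)) ℕ.z<s))) (pos* 0<a (0<x (toℕ (fromℕ k)))))
          (solve 3 (λ a r y → (:- r) :* y :+ (r :* y :+ a :* r) := a :* r) refl a r (y (suc (toℕ j)))))
      below (j , right) lt _ with combine-<⇒ {i = j} {fromℕ k} {right} {right} lt
      ... | inj₁ j<k = right-< a b j (fromℕ k , right) (on-right a b (fromℕ k))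
        (ℚ.*-monoʳ-<-pos a {{ℚ.positive 0<a}} (x-mono j<k))
      ... | inj₂ (_ , ℕ.s≤s ())

  supported-at : ∀ u → SupportedAt u
  supported-at (i , left)  = supported-left i
  supported-at (i , right) = supported-right i

  index-combine : ∀ p → p ≡ uncurry combine (index p)
  index-combine p = sym (Fin.combine-remQuot {suc k} 2 p)

  index-next : ∀ p → index (next p) ≡ succ (index p)
  index-next p = trans (cong index (trans (cong next (index-combine p)) (next-combine (index p))))
    (uncurry Fin.remQuot-combine (succ (index p)))

  supported : Supported V
  supported p with supported-at (index p)
  ... | f , level , below = f , trans level (cong (linear f ∘ vertex) (sym (index-next p))) ,
    λ q q<p q≢ → below (index q) (subst₂ Fin._<_ (index-combine q) (index-combine p) q<p)
      λ eq → q≢ (trans (index-combine q) (trans (cong (uncurry combine) (trans eq (sym (index-next p))))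
        (sym (index-combine (next p)))))

  1≤edge : ∀ u → 1ℚ ℚ.≤ ℚ.∣ proj₁ (vertex u) ℚ.- proj₁ (vertex (succ u)) ∣
  1≤edge (i , left)  = ℚ.≤-trans (1≤x (toℕ i)) (ℚ.≤-trans
    (ℚ.≤-reflexive (solve 1 (λ x → x := x :- con 0ℚ) refl (x (toℕ i))))
    (ℚ.≤-trans (p≤∣p∣ (x (toℕ i) ℚ.- 0ℚ)) (ℚ.≤-reflexive (∣p-q∣≡∣q-p∣ (x (toℕ i)) 0ℚ))))
  1≤edge (i , right) = ℚ.≤-trans (1≤x (toℕ i)) (ℚ.≤-trans
    (ℚ.≤-reflexive (solve 1 (λ x → x := x :- con 0ℚ) refl (x (toℕ i)))) (p≤∣p∣ (x (toℕ i) ℚ.- 0ℚ)))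

  -- Visits all of the left points before the right ones.
  bundled : Tour n
  bundled = Perm.cast-id (ℕ.*-comm (suc k) 2) ∘ₚ
    ↔-trans (Fin.*↔× {2} {suc k}) (↔-trans (×-comm _ _) (↔-sym (Fin.*↔× {suc k} {2})))

  side-bundled : Fin n → ℚ
  side-bundled p = side (proj₂ (index (bundled ⟨$⟩ʳ p)))

  -- `bundled` decodes a position with the side as the leading digit, so the side is the quotient by
  -- `suc k`, which grows with the position.
  side-bundled-mono : ∀ {p q} → p Fin.≤ q → side-bundled p ℚ.≤ side-bundled q
  side-bundled-mono {p} {q} p≤q = subst₂ ℚ._≤_ (sym (side-block p)) (sym (side-block q))
    (side-mono {block p} {block q} (quotient-mono {2} (suc k) {recast p} {recast q}
      (subst₂ ℕ._≤_ (sym (Fin.toℕ-cast 2*≡ p)) (sym (Fin.toℕ-cast 2*≡ q)) p≤q)))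
    where
      2*≡ : n ≡ 2 ℕ.* suc k
      2*≡ = ℕ.*-comm (suc k) 2
      recast : Fin n → Fin (2 ℕ.* suc k)
      recast = Fin.cast 2*≡
      block : Fin n → Fin 2
      block p = proj₁ (remQuot {2} (suc k) (recast p))
      side-block : ∀ p → side-bundled p ≡ side (block p)
      side-block p = cong (side ∘ proj₂)
        (Fin.remQuot-combine (proj₂ (remQuot {2} (suc k) (recast p))) (block p))

  side-bundled-variation : variation side-bundled ℚ.≤ 1ℚ ℚ.+ 1ℚ
  side-bundled-variation = ℚ.≤-trans (ℚ.≤-reflexive (variation-monotone side-bundled side-bundled-mono))
    (ℚ.+-mono-≤ rise rise)
    where
      rise : side-bundled (fromℕ _) ℚ.- side-bundled zero ℚ.≤ 1ℚ
      rise = ℚ.≤-trans (p≤∣p∣ _) (side-gap (proj₂ (index (bundled ⟨$⟩ʳ fromℕ _))) (proj₂ (index (bundled ⟨$⟩ʳ zero))))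

  module _ {η : ℚ} (x≤1+η : ∀ i → i ℕ.≤ k → x i ℚ.≤ 1ℚ ℚ.+ η)
           (∣y∣≤η : ∀ i → i ℕ.≤ k → ℚ.∣ y i ∣ ℚ.≤ η) where

    near-side : ∀ u →
      ℚ.∣ proj₁ (vertex u) ℚ.- side (proj₂ u) ∣ ℚ.+ ℚ.∣ proj₂ (vertex u) ∣ ℚ.≤ η
    near-side (i , left)  = subst (ℚ._≤ η) (sym (ℚ.+-identityˡ ℚ.∣ y (toℕ i) ∣))
      (∣y∣≤η (toℕ i) (Fin.toℕ≤pred[n] i))
    near-side (i , right) = subst (ℚ._≤ η) (sym (ℚ.+-identityʳ ℚ.∣ x (toℕ i) ℚ.- 1ℚ ∣))
      (subst (ℚ._≤ η) (sym (ℚ.0≤p⇒∣p∣≡p (gap-≤ (1≤x (toℕ i)))))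
        (≤-by-gap _ (gap-≤ (x≤1+η (toℕ i) (Fin.toℕ≤pred[n] i)))
          (solve 2 (λ x η → (x :- con 1ℚ) :+ ((con 1ℚ :+ η) :- x) := η) refl (x (toℕ i)) η)))

    wide : Wide n (ι n ℚ.* (η ℚ.+ η))
    wide = spread⇒wide V (side ∘ proj₂ ∘ index) zero bundled V-injective supported
      (λ p q → side-gap (proj₂ (index p)) (proj₂ (index q))) (λ p → near-side (index p))
      (λ p → subst (λ v → 1ℚ ℚ.≤ ℚ.∣ proj₁ (V p) ℚ.- proj₁ (vertex v) ∣) (sym (index-next p))
        (1≤edge (index p)))
      side-bundled-variation

-- From rational bounds to the ratio

Eventually : (ℕ → Set) → Set
Eventually P = ∃[ N ] (∀ m → N ℕ.≤ m → P m)

module _ {κ δ η : ℚ} (0≤κ : 0ℚ ℚ.≤ κ) (0≤δ : 0ℚ ℚ.≤ δ) where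

  private
    0<κ+δ+1 : 0ℚ ℚ.< (κ ℚ.+ δ) ℚ.+ 1ℚ
    0<κ+δ+1 = nonNeg+pos (nonNeg+ 0≤κ 0≤δ) 0<1

  -- In the limit cL ≤ κL - δL ≤ κ(2 + η) - 2δ ≤ 2κ ≤ M. Bounding κL from above and δL from below
  -- separately avoids any assumption on the sign of κ - δ.
  *-≤-from-bounds : ∀ c L S M → Eventually (λ m → seq c m ℚ.≤ κ ℚ.- δ) →
    (∀ m → 0ℚ ℚ.≤ seq L m) → fromℚ (1ℚ ℚ.+ 1ℚ) ≤ L → L ≤ S →
    (∀ m → seq S m ℚ.≤ (1ℚ ℚ.+ 1ℚ) ℚ.+ η) → fromℚ (κ ℚ.+ κ) ≤ M →
    κ ℚ.* η ℚ.≤ δ ℚ.+ δ → c * L ≤ M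
  *-≤-from-bounds c L S M (N₁ , c≤) 0≤L 2≤L L≤S S≤ 2κ≤M κη≤2δ ε 0<ε =
    -- The tolerance `e` is spent with factor `κ` on the upper bound for L, `δ` on its lower bound,
    -- and 1 on the bound for M.
    let e , 0<e , Be≡ε = quotient ((κ ℚ.+ δ) ℚ.+ 1ℚ) ε 0<κ+δ+1 0<ε
        N₂ , h₂ = 2≤L e 0<e
        N₃ , h₃ = L≤S e 0<e
        N₄ , h₄ = 2κ≤M e 0<e
    in (N₁ ℕ.⊔ N₂) ℕ.⊔ (N₃ ℕ.⊔ N₄) , λ m m≥ →
      let m≥₁₂ = ℕ.m⊔n≤o⇒m≤o (N₁ ℕ.⊔ N₂) (N₃ ℕ.⊔ N₄) m≥
          m≥₃₄ = ℕ.m⊔n≤o⇒n≤o (N₁ ℕ.⊔ N₂) (N₃ ℕ.⊔ N₄) m≥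
          L≤ = ℚ.≤-trans (h₃ m (ℕ.m⊔n≤o⇒m≤o N₃ N₄ m≥₃₄)) (ℚ.+-monoˡ-≤ e (S≤ m))
      in subst (λ z → seq c m ℚ.* seq L m ℚ.≤ seq M m ℚ.+ z) Be≡ε (≤-by-gap _
        (nonNeg+ (nonNeg+ (nonNeg+ (nonNeg+
          (nonNeg* (gap-≤ (c≤ m (ℕ.m⊔n≤o⇒m≤o N₁ N₂ m≥₁₂))) (0≤L m))
          (nonNeg* 0≤κ (gap-≤ L≤)))
          (nonNeg* 0≤δ (gap-≤ (h₂ m (ℕ.m⊔n≤o⇒n≤o N₁ N₂ m≥₁₂)))))
          (gap-≤ κη≤2δ))
          (gap-≤ (h₄ m (ℕ.m⊔n≤o⇒n≤o N₃ N₄ m≥₃₄))))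
        (solve 7 (λ c L M κ δ η e → let two = con 1ℚ :+ con 1ℚ in
          c :* L :+ (((((κ :- δ) :- c) :* L :+ κ :* (((two :+ η) :+ e) :- L))
            :+ δ :* ((L :+ e) :- two)) :+ ((δ :+ δ) :- κ :* η) :+ ((M :+ e) :- (κ :+ κ)))
          := M :+ ((κ :+ δ) :+ con 1ℚ) :* e)
          refl (seq c m) (seq L m) (seq M m) κ δ η e))

  -- In the limit M ≤ 2κ + η ≤ 2(κ + δ) ≤ (κ + δ)L ≤ cL.
  ≤-*-from-bounds : ∀ c L M → Eventually (λ m → κ ℚ.+ δ ℚ.≤ seq c m) →
    (∀ m → 0ℚ ℚ.≤ seq L m) → fromℚ (1ℚ ℚ.+ 1ℚ) ≤ L →
    (∀ m → seq M m ℚ.≤ (κ ℚ.+ κ) ℚ.+ η) → η ℚ.≤ δ ℚ.+ δ → M ≤ c * L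
  ≤-*-from-bounds c L M (N₁ , ≤c) 0≤L 2≤L M≤ η≤2δ ε 0<ε =
    let e , 0<e , Be≡ε = quotient ((κ ℚ.+ δ) ℚ.+ 1ℚ) ε 0<κ+δ+1 0<ε
        N₂ , h₂ = 2≤L e 0<e
    in N₁ ℕ.⊔ N₂ , λ m m≥ →
      subst (λ z → seq M m ℚ.≤ seq c m ℚ.* seq L m ℚ.+ z) Be≡ε (≤-by-gap _
        (nonNeg+ (nonNeg+ (nonNeg+ (nonNeg+
          (nonNeg* (gap-≤ (≤c m (ℕ.m⊔n≤o⇒m≤o N₁ N₂ m≥))) (0≤L m))
          (nonNeg* (nonNeg+ 0≤κ 0≤δ) (gap-≤ (h₂ m (ℕ.m⊔n≤o⇒n≤o N₁ N₂ m≥)))))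
          (gap-≤ (M≤ m))) (gap-≤ η≤2δ)) (ℚ.<⇒≤ 0<e))
        (solve 7 (λ c L M κ δ η e → let two = con 1ℚ :+ con 1ℚ in
          M :+ ((((c :- (κ :+ δ)) :* L :+ (κ :+ δ) :* ((L :+ e) :- two))
            :+ (((κ :+ κ) :+ η) :- M)) :+ ((δ :+ δ) :- η) :+ e)
          := c :* L :+ ((κ :+ δ) :+ con 1ℚ) :* e)
          refl (seq c m) (seq L m) (seq M m) κ δ η e))

module _ {n : ℕ} {κ δ η : ℚ} (X : Instance n) (0≤κ : 0ℚ ℚ.≤ κ) (0≤δ : 0ℚ ℚ.≤ δ) (2κ≡n : κ ℚ.+ κ ≡ ι n)
         (2≤ℓ : ∀ T → fromℚ (1ℚ ℚ.+ 1ℚ) ≤ ℓ X T) where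

  ratio-at-least : ∀ long short → Noncrossing X long → fromℚ (ι n) ≤ ℓ X long →
    (∀ m → seq (ℓ X short) m ℚ.≤ (1ℚ ℚ.+ 1ℚ) ℚ.+ η) → κ ℚ.* η ℚ.≤ δ ℚ.+ δ →
    ∀ c → Eventually (λ m → seq c m ℚ.≤ κ ℚ.- δ) → RatioAtLeast X c
  ratio-at-least long short noncrossing n≤ℓ-long ℓ-short≤2+η κη≤2δ c c≤ =
    long , noncrossing , λ T* shortest →
      *-≤-from-bounds 0≤κ 0≤δ c (ℓ X T*) (ℓ X short) (ℓ X long) c≤
        (ℓ-nonNeg X T*) (2≤ℓ T*) (shortest short) ℓ-short≤2+η
        (subst (λ z → fromℚ z ≤ ℓ X long) (sym 2κ≡n) n≤ℓ-long) κη≤2δ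

  ratio-at-most : (∀ T m → seq (ℓ X T) m ℚ.≤ ι n ℚ.+ η) → η ℚ.≤ δ ℚ.+ δ →
    ∀ c → Eventually (λ m → κ ℚ.+ δ ℚ.≤ seq c m) → RatioAtMost X c
  ratio-at-most ℓ≤n+η η≤2δ c ≤c T _ T* _ =
    ≤-*-from-bounds 0≤κ 0≤δ c (ℓ X T*) (ℓ X T) ≤c (ℓ-nonNeg X T*) (2≤ℓ T*)
      (λ m → subst (λ z → seq (ℓ X T) m ℚ.≤ z ℚ.+ η) (sym 2κ≡n) (ℓ≤n+η T m)) η≤2δ

-- Half of n, and the coordinates of the instances

-- The quotient `+ n / 2` is stored in lowest terms, which depend on `n`; passing to unnormalised
-- fractions avoids computing them.
n/2+n/2 : ∀ n → (+ n / 2) ℚ.+ (+ n / 2) ≡ ι n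
n/2+n/2 n = ℚ.toℚᵘ-injective (begin-equality
  ℚ.toℚᵘ ((+ n / 2) ℚ.+ (+ n / 2))
    ≃⟨ ℚ.toℚᵘ-homo-+ (+ n / 2) (+ n / 2) ⟩
  ℚ.toℚᵘ (+ n / 2) ℚᵘ.+ ℚ.toℚᵘ (+ n / 2)
    ≃⟨ ℚᵘ.+-cong (ℚ.toℚᵘ-fromℚᵘ (ℚᵘ.mkℚᵘ (+ n) 1)) (ℚ.toℚᵘ-fromℚᵘ (ℚᵘ.mkℚᵘ (+ n) 1)) ⟩
  ℚᵘ.mkℚᵘ (+ n) 1 ℚᵘ.+ ℚᵘ.mkℚᵘ (+ n) 1
    ≃⟨ ℚᵘ.*≡* (trans (ℤ.*-identityʳ _) (sym (ℤ.*-distribˡ-+ (+ n) (+ 2) (+ 2)))) ⟩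
  ℚᵘ.mkℚᵘ (+ n) 0
    ≃⟨ toℚᵘ-ι n ⟨
  ℚ.toℚᵘ (ι n) ∎)
  where open ℚᵘ.≤-Reasoning

0<ι : ∀ n → 0ℚ ℚ.< ι (suc n)
0<ι n = subst (0ℚ ℚ.<_) (ℚ.+-comm (ι n) 1ℚ) (nonNeg+pos (0≤ι n) 0<1)

ι-mono-< : ∀ {i j} → i ℕ.< j → ι i ℚ.< ι j
ι-mono-< {i} i<j = ℚ.<-≤-trans (subst (ι i ℚ.<_) (ℚ.+-comm (ι i) 1ℚ) (p<p+q (ι i) 0<1)) (ι-mono i<j)

n/2-pos : ∀ n → 0ℚ ℚ.< + suc n / 2
n/2-pos n = subst (0ℚ ℚ.<_)
  (trans (cong (ℚ._* ½) (sym (n/2+n/2 (suc n))))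
    (solve 1 (λ p → (p :+ p) :* con ½ := p) refl (+ suc n / 2)))
  (pos* (0<ι n) 0<½)

double-swap : ∀ p q → p ℚ.* (q ℚ.+ q) ≡ (p ℚ.+ p) ℚ.* q
double-swap = solve 2 (λ p q → p :* (q :+ q) := (p :+ p) :* q) refl

module Thin (k : ℕ) {h : ℚ} (0<h : 0ℚ ℚ.< h) where

  -- Subtracting ½ makes `y 0` negative and every later `y i` positive while keeping the equal steps
  -- `h`.
  x y : ℕ → ℚ
  x i = 1ℚ ℚ.+ ι i ℚ.* h
  y i = (ι i ℚ.- ½) ℚ.* h

  x-mono : ∀ {i j} → i ℕ.< j → x i ℚ.< x j
  x-mono i<j = ℚ.+-monoʳ-< 1ℚ (ℚ.*-monoˡ-<-pos h {{ℚ.positive 0<h}} (ι-mono-< i<j))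

  y-mono : ∀ {i j} → i ℕ.< j → y i ℚ.< y j
  y-mono i<j = ℚ.*-monoˡ-<-pos h {{ℚ.positive 0<h}} (ℚ.+-monoˡ-< (ℚ.- ½) (ι-mono-< i<j))

  0<½h : 0ℚ ℚ.< ½ ℚ.* h
  0<½h = pos* 0<½ 0<h

  y₀<0 : y 0 ℚ.< 0ℚ
  y₀<0 = <-by-gap (½ ℚ.* h) 0<½h
    (solve 1 (λ h → (con 0ℚ :- con ½) :* h :+ con ½ :* h := con 0ℚ) refl h)

  0<y₁ : 0ℚ ℚ.< y 1
  0<y₁ = <-by-gap (½ ℚ.* h) 0<½h
    (solve 1 (λ h → con 0ℚ :+ con ½ :* h := ((con 1ℚ :+ con 0ℚ) :- con ½) :* h) refl h)

  1≤x₀ : 1ℚ ℚ.≤ x 0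
  1≤x₀ = ≤-by-gap (0ℚ ℚ.* h) (ℚ.≤-reflexive (sym (ℚ.*-zeroˡ h))) refl

  ιh-mono : ∀ {i} → i ℕ.≤ k → ι i ℚ.* h ℚ.≤ ι (suc k) ℚ.* h
  ιh-mono i≤k = ℚ.*-monoʳ-≤-nonNeg h {{ℚ.nonNegative (ℚ.<⇒≤ 0<h)}} (ι-mono (ℕ.m≤n⇒m≤1+n i≤k))

  x≤ : ∀ i → i ℕ.≤ k → x i ℚ.≤ 1ℚ ℚ.+ ι (suc k) ℚ.* h
  x≤ i i≤k = ℚ.+-monoʳ-≤ 1ℚ (ιh-mono i≤k)

  -- The factor is `suc k` rather than `k` so that `y 0` = -h/2 is covered even for k = 0.
  ∣y∣≤ : ∀ i → i ℕ.≤ k → ℚ.∣ y i ∣ ℚ.≤ ι (suc k) ℚ.* h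
  ∣y∣≤ i i≤k = ∣-∣≤
    (ℚ.≤-trans (≤-by-gap (½ ℚ.* h) (ℚ.<⇒≤ 0<½h)
      (solve 2 (λ i h → (i :- con ½) :* h :+ con ½ :* h := i :* h) refl (ι i) h)) (ιh-mono i≤k))
    (≤-by-gap ((½ ℚ.* h) ℚ.+ (ι i ℚ.* h ℚ.+ ι k ℚ.* h))
      (nonNeg+ (ℚ.<⇒≤ 0<½h) (nonNeg+ (nonNeg* (0≤ι i) (ℚ.<⇒≤ 0<h)) (nonNeg* (0≤ι k) (ℚ.<⇒≤ 0<h))))
      (solve 3 (λ i k h → (:- ((i :- con ½) :* h)) :+ (con ½ :* h :+ (i :* h :+ k :* h))
        := (con 1ℚ :+ k) :* h) refl (ι i) (ι k) h))

thin : ∀ k {η} → 0ℚ ℚ.< η → Wide (suc k ℕ.* 2) η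
thin k {η} 0<η =
  -- `e` = η/(2n) is the displacement allowed per point, and `h` = e/(k + 1) makes the outermost
  -- points respect it.
  let e , 0<e , 2ne≡η = quotient (ι (suc k ℕ.* 2) ℚ.+ ι (suc k ℕ.* 2)) η
        (nonNeg+pos (0≤ι (suc k ℕ.* 2)) (0<ι (suc (k ℕ.* 2)))) 0<η
      h , 0<h , kh≡e = quotient (ι (suc k)) e (0<ι k) 0<e
      open Thin k 0<h
  in subst (Wide (suc k ℕ.* 2))
       (trans (double-swap (ι (suc k ℕ.* 2)) (ι (suc k) ℚ.* h))
         (trans (cong ((ι (suc k ℕ.* 2) ℚ.+ ι (suc k ℕ.* 2)) ℚ.*_) kh≡e) 2ne≡η))
       (Zigzag.wide k x y x-mono y-mono 1≤x₀ y₀<0 0<y₁ x≤ ∣y∣≤)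

-- From rational margins to the real statement

-- The factor `c` is any real whose approximations eventually respect a rational margin `δ`, so the
-- same property yields κ(1 - ε), κ - δ and κ + δ for real ε and δ.
Attains : ∀ {n} → Instance n → ℚ → ℚ → Set
Attains X κ δ = (∀ c → Eventually (λ m → seq c m ℚ.≤ κ ℚ.- δ) → RatioAtLeast X c)
              × (∀ c → Eventually (λ m → κ ℚ.+ δ ℚ.≤ seq c m) → RatioAtMost X c)

wide⇒attains : ∀ {n κ δ η} → 0ℚ ℚ.≤ κ → 0ℚ ℚ.≤ δ → κ ℚ.+ κ ≡ ι n →
  κ ℚ.* η ℚ.≤ δ ℚ.+ δ → η ℚ.≤ δ ℚ.+ δ → Wide n η → ∃[ X ] Attains {n} X κ δ
wide⇒attains 0≤κ 0≤δ 2κ≡n κη≤2δ η≤2δ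
  (X , long , short , noncrossing , 2≤ℓ , ℓ≤n+η , n≤ℓ-long , ℓ-short≤2+η) = X
  , ratio-at-least X 0≤κ 0≤δ 2κ≡n 2≤ℓ long short noncrossing n≤ℓ-long ℓ-short≤2+η κη≤2δ
  , ratio-at-most X 0≤κ 0≤δ 2κ≡n 2≤ℓ ℓ≤n+η η≤2δ

close-to-half : ∀ k κ δ → 0ℚ ℚ.≤ κ → κ ℚ.+ κ ≡ ι (suc k ℕ.* 2) → 0ℚ ℚ.< δ →
  ∃[ X ] Attains {suc k ℕ.* 2} X κ δ
close-to-half k κ δ 0≤κ 2κ≡n 0<δ =
  let 0≤δ = ℚ.<⇒≤ 0<δ
      -- The choice η = 2δ/(κ + 1) gives κη ≤ 2δ for the lower bound on the ratio and η ≤ 2δ for the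
      -- upper bound.
      η , 0<η , [κ+1]η≡2δ = quotient (κ ℚ.+ 1ℚ) (δ ℚ.+ δ) (nonNeg+pos 0≤κ 0<1) (nonNeg+pos 0≤δ 0<δ)
      0≤η = ℚ.<⇒≤ 0<η
  in wide⇒attains 0≤κ 0≤δ 2κ≡n
       (≤-by-gap η 0≤η
         (trans (solve 2 (λ κ η → κ :* η :+ η := (κ :+ con 1ℚ) :* η) refl κ η) [κ+1]η≡2δ))
       (≤-by-gap (κ ℚ.* η) (nonNeg* 0≤κ 0≤η)
         (trans (solve 2 (λ κ η → η :+ κ :* η := (κ :+ con 1ℚ) :* η) refl κ η) [κ+1]η≡2δ))
       (thin k 0<η)

-- The second component makes "arbitrarily close" two-sided: a single instance has its ratio within
-- `δ` of `κ` from below and above.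
ApproachesRatio : ℕ → ℚ → Set
ApproachesRatio n κ =
  (∃[ ε₀ ] 0ℝ < ε₀ × (∀ (ε : ℝ) → 0ℝ < ε → ε < ε₀ → ∃[ X ] RatioAtLeast {n} X (fromℚ κ * (1ℝ - ε))))
  × (∀ (δ : ℝ) → 0ℝ < δ → ∃[ X ] RatioAtLeast {n} X (fromℚ κ - δ) × RatioAtMost {n} X (fromℚ κ + δ))

attains⇒approaches : ∀ {n κ} → 0ℚ ℚ.< κ → (∀ δ → 0ℚ ℚ.< δ → ∃[ X ] Attains {n} X κ δ) →
  ApproachesRatio n κ
attains⇒approaches {n} {κ} 0<κ attains = (1ℝ , (1ℚ , 0<1 , 0 , λ _ _ → ℚ.≤-refl) , first) , second
  where
    first : ∀ (ε : ℝ) → 0ℝ < ε → ε < 1ℝ → ∃[ X ] RatioAtLeast {n} X (fromℚ κ * (1ℝ - ε))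
    first ε (e , 0<e , N , e≤ε) _ =
      -- Positivity of the real `ε` provides a rational e > 0 eventually below it, whence κ(1 - ε) ≤
      -- κ - κe.
      let X , at-least , _ = attains (κ ℚ.* e) (pos* 0<κ 0<e)
      in X , at-least (fromℚ κ * (1ℝ - ε)) (N , λ m m≥ →
        ≤-by-gap (κ ℚ.* (seq ε m ℚ.- (0ℚ ℚ.+ e))) (nonNeg* (ℚ.<⇒≤ 0<κ) (gap-≤ (e≤ε m m≥)))
          (solve 3 (λ κ ε e → κ :* (con 1ℚ :- ε) :+ κ :* (ε :- (con 0ℚ :+ e)) := κ :- κ :* e)
            refl κ (seq ε m) e))
    second : ∀ (δ : ℝ) → 0ℝ < δ → ∃[ X ] RatioAtLeast {n} X (fromℚ κ - δ) × RatioAtMost {n} X (fromℚ κ + δ)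
    second δ (d , 0<d , N , d≤δ) =
      let X , at-least , at-most = attains d 0<d
      in X
       , at-least (fromℚ κ - δ) (N , λ m m≥ → ≤-by-gap (seq δ m ℚ.- (0ℚ ℚ.+ d)) (gap-≤ (d≤δ m m≥))
           (solve 3 (λ κ δ d → (κ :- δ) :+ (δ :- (con 0ℚ :+ d)) := κ :- d) refl κ (seq δ m) d))
       , at-most (fromℚ κ + δ) (N , λ m m≥ → ≤-by-gap (seq δ m ℚ.- (0ℚ ℚ.+ d)) (gap-≤ (d≤δ m m≥))
           (solve 3 (λ κ δ d → (κ :+ d) :+ (δ :- (con 0ℚ :+ d)) := κ :+ δ) refl κ (seq δ m) d))

empty : Instance 0
empty = record { pt = λ () ; distinct = λ { {()} } }

-- Without points every tour has length 0, so both ratio inequalities hold for any factor.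
approaches-empty : ∀ κ → ApproachesRatio 0 κ
approaches-empty κ =
    (1ℝ , (1ℚ , 0<1 , 0 , λ _ _ → ℚ.≤-refl) , λ ε _ _ → empty , at-least (fromℚ κ * (1ℝ - ε)))
  , λ δ _ → empty , at-least (fromℚ κ - δ) , at-most (fromℚ κ + δ)
  where
    c*0≡0 : ∀ c m → seq c m ℚ.* 0ℚ ≡ 0ℚ
    c*0≡0 c m = ℚ.*-zeroʳ (seq c m)
    0≤0+ε : ∀ {ε} → 0ℚ ℚ.< ε → 0ℚ ℚ.≤ 0ℚ ℚ.+ ε
    0≤0+ε 0<ε = ℚ.<⇒≤ (p<p+q 0ℚ 0<ε)
    at-least : ∀ c → RatioAtLeast empty c
    at-least c = Perm.id , (λ ()) , λ _ _ ε 0<ε → 0 , λ m _ →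
      subst (ℚ._≤ 0ℚ ℚ.+ ε) (sym (c*0≡0 c m)) (0≤0+ε 0<ε)
    at-most : ∀ c → RatioAtMost empty c
    at-most c _ _ _ _ ε 0<ε = 0 , λ m _ → subst (λ z → 0ℚ ℚ.≤ z ℚ.+ ε) (sym (c*0≡0 c m)) (0≤0+ε 0<ε)

theorem1 : ∀ (n : ℕ) → 2 ∣ n →
    (∃[ ε₀ ] 0ℝ < ε₀ × (∀ (ε : ℝ) → 0ℝ < ε → ε < ε₀ →
    ∃[ X ] RatioAtLeast {n} X (fromℚ (+ n / 2) * (1ℝ - ε))))
    × (∀ (δ : ℝ) → 0ℝ < δ →
    ∃[ X ] RatioAtLeast {n} X (fromℚ (+ n / 2) - δ)
    × RatioAtMost {n} X (fromℚ (+ n / 2) + δ))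
theorem1 _ (divides zero refl)    = approaches-empty (+ 0 / 2)
theorem1 _ (divides (suc k) refl) = attains⇒approaches (n/2-pos (suc (k ℕ.* 2)))
  λ δ 0<δ → close-to-half k (+ (suc k ℕ.* 2) / 2) δ (ℚ.<⇒≤ (n/2-pos (suc (k ℕ.* 2))))
    (n/2+n/2 (suc k ℕ.* 2)) 0<δ
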